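{- Let $\kappa$ be a Mahlo cardinal and let $\lambda,\lambda'$ be cardinals with $\kappa\le\lambda<\lambda'$. Suppose $S\subseteq\mathcal{P}_\kappa\lambda$. If $S\uparrow\lambda'$ is $2$-stationary in $\mathcal{P}_\kappa\lambda'$, then $S$ is $2$-stationary in $\mathcal{P}_\kappa\lambda$.
   Context: For a set $A$, $\mathcal{P}_\kappa A=\{x\subseteq A:|x|<\kappa\}$. A weakly inaccessible cardinal is an uncountable regular limit cardinal. A Mahlo cardinal is a strongly inaccessible cardinal in which the set of smaller inaccessible cardinals is stationary. Definition of $n$-stationarity, by recursion on $n<\omega$, simultaneously for all weakly inaccessible cardinals $\kappa$ and all sets $A\supseteq\kappa$: - $S\subseteq\mathcal{P}_\kappa A$ is $0$-stationary in $\mathcal{P}_\kappa A$ if it is unbounded, i.e. for every $x\in\mathcal{P}_\kappa A$ there is $y\in S$ with $x\subseteq y$. - For $n>0$, $S\subseteq\mathcal{P}_\kappa A$ is $n$-stationary in $\mathcal{P}_\kappa A$ if for all $m<n$ and all $m$-stationary $T\subseteq\mathcal{P}_\kappa A$ there is $x\in S$ such that $\mu:=x\cap\kappa$ is a weakly inaccessible cardinal and $T\cap\mathcal{P}_\mu x$ is $m$-stationary in $\mathcal{P}_\mu x$. For $\kappa\subseteq A\subseteq B$ and $S\subseteq\mathcal{P}_\kappa A$, $S\uparrow B:=\{y\in\mathcal{P}_\kappa B: y\cap A\in S\}$; here $S\uparrow\lambda'$ is taken with $A=\lambda$, $B=\lambda'$. -}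

module Defs where

open import Level using (Level)
open import Data.Nat.Base using (ℕ; zero; suc; _<_; s≤s)
open import Data.Nat.Properties using (≤-refl; m≤n⇒m≤1+n; m≤n⇒m<n∨m≡n)
open import Data.Fin.Base using (Fin)
open import Data.Vec.Base using (Vec; _∷_; lookup)
open import Data.Product.Base using (_×_; _,_; ∃-syntax)
open import Data.Sum.Base using (_⊎_; inj₁; inj₂)
open import Data.Unit.Polymorphic.Base using (⊤; tt)
open import Function.Bundles using (_⇔_; mk⇔)
open import Relation.Nullary.Negation.Core using (¬_)
open import Relation.Binary.PropositionalEquality.Core using (_≡_; refl)

-- First-order formulas of the language {∈, =} with n free variables (de Bruijn).
-- They are needed only for the axiom schemata of separation and replacement.

infix  9 _∈′_ _≐_
infix  8 ¬′_
infixr 7 _∧′_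
infixr 6 _∨′_
infixr 5 _⇒′_
infix  4 _⇔′_

data Formula (n : ℕ) : Set where
  _∈′_ _≐_                  : Fin n → Fin n → Formula n
  ¬′_                       : Formula n → Formula n
  _∧′_ _∨′_ _⇒′_ _⇔′_       : Formula n → Formula n → Formula n
  ∀′_ ∃′_                   : Formula (suc n) → Formula n

-- V is the domain of discourse: its elements are the sets of the theory, _∈_ is
-- membership, and = is interpreted by _≡_.

module SetTheory {ℓ : Level} (V : Set ℓ) (_∈_ : V → V → Set ℓ) where

  infix 4 _⊆_

  -- Tarskian satisfaction; variable 0 is the head of the environment.

  Sat : ∀ {n} → Formula n → Vec V n → Set ℓ
  Sat (i ∈′ j) ρ = lookup ρ i ∈ lookup ρ j
  Sat (i ≐ j)  ρ = lookup ρ i ≡ lookup ρ j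
  Sat (¬′ φ)   ρ = ¬ Sat φ ρ
  Sat (φ ∧′ ψ) ρ = Sat φ ρ × Sat ψ ρ
  Sat (φ ∨′ ψ) ρ = Sat φ ρ ⊎ Sat ψ ρ
  Sat (φ ⇒′ ψ) ρ = Sat φ ρ → Sat ψ ρ
  Sat (φ ⇔′ ψ) ρ = Sat φ ρ ⇔ Sat ψ ρ
  Sat (∀′ φ)   ρ = ∀ x → Sat φ (x ∷ ρ)
  Sat (∃′ φ)   ρ = ∃[ x ] Sat φ (x ∷ ρ)

  -- Set-theoretic operations are expressed by their graphs: "IsOp r x y" says
  -- r = op(x, y).

  _⊆_ : V → V → Set ℓ
  x ⊆ y = ∀ z → z ∈ x → z ∈ y

  Nonempty : V → Set ℓ
  Nonempty x = ∃[ y ] y ∈ x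

  IsPower : V → V → Set ℓ
  IsPower p x = ∀ z → z ∈ p ⇔ z ⊆ x

  IsIntersection : V → V → V → Set ℓ
  IsIntersection i x y = ∀ z → z ∈ i ⇔ (z ∈ x × z ∈ y)

  -- s = x ∪ {x}
  IsSuccessor : V → V → Set ℓ
  IsSuccessor s x = ∀ z → z ∈ s ⇔ (z ∈ x ⊎ z ≡ x)

  IsUnorderedPair : V → V → V → Set ℓ
  IsUnorderedPair p x y = ∀ z → z ∈ p ⇔ (z ≡ x ⊎ z ≡ y)

  -- p = {{x}, {x, y}}
  IsOrderedPair : V → V → V → Set ℓ
  IsOrderedPair p x y =
    ∃[ a ] ∃[ b ] IsUnorderedPair a x x × IsUnorderedPair b x y × IsUnorderedPair p a b

  -- (x, y) ∈ f
  Maps : V → V → V → Set ℓ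
  Maps f x y = ∃[ p ] IsOrderedPair p x y × p ∈ f

  IsFunction : V → V → V → Set ℓ
  IsFunction f a b =
    (∀ p → p ∈ f → ∃[ x ] ∃[ y ] x ∈ a × y ∈ b × IsOrderedPair p x y) ×
    (∀ x → x ∈ a → ∃[ y ] Maps f x y × (∀ z → Maps f x z → z ≡ y))

  IsBijection : V → V → V → Set ℓ
  IsBijection f a b =
    IsFunction f a b ×
    (∀ x x′ y → Maps f x y → Maps f x′ y → x ≡ x′) ×
    (∀ y → y ∈ b → ∃[ x ] Maps f x y)

  Equinumerous : V → V → Set ℓ
  Equinumerous a b = ∃[ f ] IsBijection f a b

  IsEmpty : V → Set ℓ
  IsEmpty x = ∀ y → ¬ (y ∈ x)

  Inductive : V → Set ℓ
  Inductive w =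
    (∃[ e ] IsEmpty e × e ∈ w) ×
    (∀ x → x ∈ w → ∃[ s ] IsSuccessor s x × s ∈ w)

  record ZFC : Set ℓ where
    field
      extensionality : ∀ x y → (∀ z → z ∈ x ⇔ z ∈ y) → x ≡ y
      foundation     : ∀ x → Nonempty x → ∃[ y ] y ∈ x × (∀ z → z ∈ y → ¬ (z ∈ x))
      pairing        : ∀ x y → ∃[ p ] IsUnorderedPair p x y
      union          : ∀ x → ∃[ u ] ∀ z → z ∈ u ⇔ (∃[ y ] y ∈ x × z ∈ y)
      power          : ∀ x → ∃[ p ] IsPower p x
      infinity       : ∃[ w ] Inductive w
      separation     : ∀ {n} (φ : Formula (suc n)) (ρ : Vec V n) a →
                       ∃[ b ] ∀ x → x ∈ b ⇔ (x ∈ a × Sat φ (x ∷ ρ))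
      replacement    : ∀ {n} (φ : Formula (suc (suc n))) (ρ : Vec V n) a →
                       (∀ x → x ∈ a → ∀ y z →
                         Sat φ (x ∷ y ∷ ρ) → Sat φ (x ∷ z ∷ ρ) → y ≡ z) →
                       ∃[ b ] ∀ y → y ∈ b ⇔ (∃[ x ] x ∈ a × Sat φ (x ∷ y ∷ ρ))
      choice         : ∀ a → (∀ x → x ∈ a → Nonempty x) →
                       ∃[ f ] ∃[ b ] IsFunction f a b ×
                         (∀ x y → x ∈ a → Maps f x y → y ∈ x)

  Transitive : V → Set ℓ
  Transitive x = ∀ y → y ∈ x → y ⊆ x

  -- ∈ is a strict well-order of x.
  WellOrdered : V → Set ℓ
  WellOrdered x =
    (∀ y → y ∈ x → ¬ (y ∈ y)) ×
    (∀ y z w → y ∈ x → z ∈ x → w ∈ x → y ∈ z → z ∈ w → y ∈ w) ×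
    (∀ y z → y ∈ x → z ∈ x → y ∈ z ⊎ y ≡ z ⊎ z ∈ y) ×
    (∀ s → s ⊆ x → Nonempty s → ∃[ m ] m ∈ s × (∀ y → y ∈ s → m ≡ y ⊎ m ∈ y))

  Ordinal : V → Set ℓ
  Ordinal α = Transitive α × WellOrdered α

  LimitOrdinal : V → Set ℓ
  LimitOrdinal α = Ordinal α × Nonempty α × (∀ β → β ∈ α → ∃[ γ ] γ ∈ α × β ∈ γ)

  _≤ₒ_ : V → V → Set ℓ
  α ≤ₒ β = α ∈ β ⊎ α ≡ β

  IsOmega : V → Set ℓ
  IsOmega w = Inductive w × (∀ v → Inductive v → w ⊆ v)

  Cardinal : V → Set ℓ
  Cardinal κ = Ordinal κ × (∀ α → α ∈ κ → ¬ Equinumerous α κ)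

  -- μ = |x|
  IsCardinality : V → V → Set ℓ
  IsCardinality μ x = Cardinal μ × Equinumerous x μ

  ∣_∣<_ : V → V → Set ℓ
  ∣ x ∣< κ = ∃[ μ ] IsCardinality μ x × μ ∈ κ

  Uncountable : V → Set ℓ
  Uncountable κ = ∃[ w ] IsOmega w × w ∈ κ

  IsCofinalMap : V → V → V → Set ℓ
  IsCofinalMap f α κ =
    IsFunction f α κ ×
    (∀ γ → γ ∈ κ → ∃[ ξ ] ∃[ δ ] ξ ∈ α × Maps f ξ δ × γ ≤ₒ δ)

  -- κ is an infinite cardinal with cf(κ) = κ.
  Regular : V → Set ℓ
  Regular κ =
    Cardinal κ × LimitOrdinal κ × (∀ α → α ∈ κ → ¬ (∃[ f ] IsCofinalMap f α κ))

  LimitCardinal : V → Set ℓ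
  LimitCardinal κ =
    Cardinal κ × (∀ ν → ν ∈ κ → Cardinal ν → ∃[ ν′ ] Cardinal ν′ × ν′ ∈ κ × ν ∈ ν′)

  -- 2^ν is |𝒫(ν)|.
  StrongLimit : V → Set ℓ
  StrongLimit κ =
    Cardinal κ × (∀ ν → ν ∈ κ → Cardinal ν → ∀ p → IsPower p ν → ∣ p ∣< κ)

  WeaklyInaccessible : V → Set ℓ
  WeaklyInaccessible κ = Uncountable κ × Regular κ × LimitCardinal κ

  StronglyInaccessible : V → Set ℓ
  StronglyInaccessible κ = Uncountable κ × Regular κ × StrongLimit κ

  IsClub : V → V → Set ℓ
  IsClub c κ =
    c ⊆ κ ×
    (∀ β → β ∈ κ → ∃[ γ ] γ ∈ c × β ∈ γ) ×
    (∀ α → α ∈ κ → LimitOrdinal α →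
      (∀ β → β ∈ α → ∃[ γ ] γ ∈ c × γ ∈ α × β ∈ γ) → α ∈ c)

  -- Stationarity of sets of ordinals, as opposed to the notion on 𝒫_κ A below.
  IsStationarySubset : V → V → Set ℓ
  IsStationarySubset e κ =
    e ⊆ κ × (∀ c → IsClub c κ → ∃[ α ] α ∈ c × α ∈ e)

  Mahlo : V → Set ℓ
  Mahlo κ =
    StronglyInaccessible κ ×
    (∃[ e ] (∀ α → α ∈ e ⇔ (α ∈ κ × StronglyInaccessible α)) × IsStationarySubset e κ)

  _∈𝒫[_]_ : V → V → V → Set ℓ
  x ∈𝒫[ κ ] A = x ⊆ A × ∣ x ∣< κ

  _⊆𝒫[_]_ : V → V → V → Set ℓ
  S ⊆𝒫[ κ ] A = ∀ x → x ∈ S → x ∈𝒫[ κ ] A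

  Unbounded : V → V → V → Set ℓ
  Unbounded κ A S = ∀ x → x ∈𝒫[ κ ] A → ∃[ y ] y ∈ S × x ⊆ y

  -- R = T ∩ 𝒫_μ x
  IsTrace : V → V → V → V → Set ℓ
  IsTrace R T μ x = ∀ z → z ∈ R ⇔ (z ∈ T × z ∈𝒫[ μ ] x)

  -- The clause of the recursion for a single m, where P is m-stationarity.
  Reflects : (V → V → V → Set ℓ) → V → V → V → Set ℓ
  Reflects P κ A S =
    ∀ T → T ⊆𝒫[ κ ] A → P κ A T →
    ∃[ x ] ∃[ μ ] ∃[ R ]
      x ∈ S × IsIntersection μ x κ × WeaklyInaccessible μ × IsTrace R T μ x × P μ x R

  -- "Stationary n κ A S" says that S is n-stationary in 𝒫_κ A. It is meaningful
  -- when κ is weakly inaccessible, κ ⊆ A and S ⊆ 𝒫_κ A; these conditions persist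
  -- in the recursive calls. The quantifier "for all m < n" is written as an
  -- iterated conjunction to make the recursion structural; see stationary-suc.
  mutual
    Stationary : ℕ → V → V → V → Set ℓ
    Stationary zero    = Unbounded
    Stationary (suc n) = ReflectsBelow (suc n)

    ReflectsBelow : ℕ → V → V → V → Set ℓ
    ReflectsBelow zero    κ A S = ⊤
    ReflectsBelow (suc n) κ A S = ReflectsBelow n κ A S × Reflects (Stationary n) κ A S

  reflectsBelow : ∀ n κ A S →
    ReflectsBelow n κ A S ⇔ (∀ m → m < n → Reflects (Stationary m) κ A S)
  reflectsBelow n κ A S = mk⇔ (to n) (from n)
    where
    to : ∀ n → ReflectsBelow n κ A S → ∀ m → m < n → Reflects (Stationary m) κ A S
    to (suc n) (below , last) m (s≤s m≤n) with m≤n⇒m<n∨m≡n m≤n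
    ... | inj₁ m<n  = to n below m m<n
    ... | inj₂ refl = last

    from : ∀ n → (∀ m → m < n → Reflects (Stationary m) κ A S) → ReflectsBelow n κ A S
    from zero    h = tt
    from (suc n) h = from n (λ m m<n → h m (m≤n⇒m≤1+n m<n)) , h n ≤-refl

  stationary-suc : ∀ n κ A S →
    Stationary (suc n) κ A S ⇔ (∀ m → m < suc n → Reflects (Stationary m) κ A S)
  stationary-suc n = reflectsBelow (suc n)

  -- U = S ↑ B, for S ⊆ 𝒫_κ A
  IsLift : V → V → V → V → V → Set ℓ
  IsLift U S κ A B =
    ∀ y → y ∈ U ⇔ (y ∈𝒫[ κ ] B × (∃[ z ] IsIntersection z y A × z ∈ S))

{-# OPTIONS --safe #-}
-- If T reflects unbounded sets in 𝒫_κ λ, then so does T ↑ λ′ in 𝒫_κ λ′: this is the heart of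
-- the proof, since conversely reflection of unbounded sets by a lift projects down by
-- intersecting with λ. Let U be unbounded in 𝒫_κ λ′ and choose f(w) ∈ U with w ⊆ f(w).
-- It suffices to find x′ ∈ T ↑ λ′ closed under f on 𝒫_μ x′, where μ = x′ ∩ κ. For this one lets T
-- reflect the family of all v whose subsets z have closures under f (on subsets of size in
-- z ∩ κ) that add no element of λ to v. That family is unbounded because every small set is
-- contained in a small y closed under f on 𝒫_(y ∩ κ) y: build a continuous increasing chain
-- of small sets of length κ; the ordinals v ∩ κ, for v in the chain, form a club, and at an
-- inaccessible point of it regularity makes v closed.

module Submission where

open import Defs
open import Level using (Level)
open import Axiom.ExcludedMiddle using (ExcludedMiddle)
open import Data.Nat.Base using (suc)
open import Data.Fin.Base using (Fin; zero; suc)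
open import Data.Vec.Base using (Vec; []; _∷_)
open import Data.Product.Base using (_×_; _,_; proj₁; proj₂; ∃-syntax)
open import Data.Sum.Base using (_⊎_; inj₁; inj₂; [_,_]′; map₂)
open import Data.Empty using (⊥; ⊥-elim)
open import Data.Unit.Polymorphic.Base using (tt)
open import Function.Base using (id; _∘_; case_of_)
open import Function.Bundles using (_⇔_; mk⇔; Equivalence)
open import Relation.Nullary using (¬_; yes; no)
open import Relation.Binary.PropositionalEquality using (_≡_; _≢_; refl; sym; trans; subst)

open Equivalence using (to; from)

-- In the clause `m = 1` a 1-stationary `T` is carried up to 𝒫_κ λ′, and a reflecting trace of its
-- lift is brought back down. The way down happens at `μ`, about which only weak inaccessibility is
-- known; hence projection is proved for arbitrary regular cardinals. The way up happens at `κ`, and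
-- there the Mahlo property is spent. The obstacle on the way up is that `μ` becomes known only
-- after `T` has reflected, so closure cannot be stated with `μ` as the bound on sizes; ordinals
-- belonging to the sets themselves serve as bounds. Also, f(w) must have size below `μ`, so the
-- operator `e` adds the size of f(w) as an extra element: closure puts that ordinal into x′ ∩ κ =
-- μ. Comprehension is restricted to first-order formulas. Each predicate is therefore phrased so
-- that `Sat` of the accompanying formula reduces to it, and `refl` proves their agreement.

pattern i0 = zero
pattern i1 = suc i0
pattern i2 = suc i1
pattern i3 = suc i2
pattern i4 = suc i3
pattern i5 = suc i4
pattern i6 = suc i5
pattern i7 = suc i6
pattern i8 = suc i7
pattern i9 = suc i8

-- Formulas for the notions that occur in comprehensions

infix 9 _⊆′_

_⊆′_ : ∀ {n} → Fin n → Fin n → Formula n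
x ⊆′ y = ∀′ (i0 ∈′ suc x ⇒′ i0 ∈′ suc y)

unorderedPair′ : ∀ {n} → Fin n → Fin n → Fin n → Formula n
unorderedPair′ p x y = ∀′ (i0 ∈′ suc p ⇔′ i0 ≐ suc x ∨′ i0 ≐ suc y)

orderedPair′ : ∀ {n} → Fin n → Fin n → Fin n → Formula n
orderedPair′ p x y = ∃′ ∃′
  (unorderedPair′ i1 (suc (suc x)) (suc (suc x)) ∧′
   unorderedPair′ i0 (suc (suc x)) (suc (suc y)) ∧′
   unorderedPair′ (suc (suc p)) i1 i0)

maps′ : ∀ {n} → Fin n → Fin n → Fin n → Formula n
maps′ f x y = ∃′ (orderedPair′ i0 (suc x) (suc y) ∧′ i0 ∈′ suc f)

infix 9 _≼′_

_≼′_ : ∀ {n} → Fin n → Fin n → Formula n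
x ≼′ y = ∃′
  (∀′ (i0 ∈′ suc (suc x) ⇒′ ∃′ (i0 ∈′ suc (suc (suc y)) ∧′ maps′ i2 i1 i0)) ∧′
   ∀′ ∀′ ∀′ (maps′ i3 i2 i0 ⇒′ maps′ i3 i1 i0 ⇒′ i2 ≐ i1))

small′ : ∀ {n} → Fin n → Fin n → Formula n
small′ κ x = ∃′ (i0 ∈′ suc κ ∧′ suc x ≼′ i0)
bijection′ : ∀ {n} → Fin n → Fin n → Fin n → Formula n
bijection′ f x y =
  (∀′ (i0 ∈′ suc f ⇒′
    ∃′ ∃′ (i1 ∈′ suc (suc (suc x)) ∧′ i0 ∈′ suc (suc (suc y)) ∧′ orderedPair′ i2 i1 i0)) ∧′
   ∀′ (i0 ∈′ suc x ⇒′
    ∃′ (maps′ (suc (suc f)) i1 i0 ∧′ ∀′ (maps′ (suc (suc (suc f))) i2 i0 ⇒′ i0 ≐ i1)))) ∧′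
  ∀′ ∀′ ∀′ (maps′ (suc (suc (suc f))) i2 i0 ⇒′ maps′ (suc (suc (suc f))) i1 i0 ⇒′ i2 ≐ i1) ∧′
  ∀′ (i0 ∈′ suc y ⇒′ ∃′ maps′ (suc (suc f)) i0 i1)

bisimulation′ : ∀ {n} → Fin n → Fin n → Formula n
bisimulation′ x r = ∀′ ∀′ (maps′ (suc (suc r)) i1 i0 ⇒′
  ∀′ (i0 ∈′ suc (suc (suc x)) ⇒′ i0 ∈′ i2 ⇒′
    ∃′ (i0 ∈′ i2 ∧′ maps′ (suc (suc (suc (suc r)))) i1 i0)) ∧′
  ∀′ (i0 ∈′ i1 ⇒′
    ∃′ (i0 ∈′ suc (suc (suc (suc x))) ∧′ i0 ∈′ i3 ∧′ maps′ (suc (suc (suc (suc r)))) i0 i1)))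

bound′ : ∀ {n} (x f r κ ξ δ : Fin n) → Formula n
bound′ x f r κ ξ δ = ∀′ (i0 ∈′ suc x ⇒′ maps′ (suc f) i0 (suc ξ) ⇒′
  ∀′ (i0 ∈′ suc (suc κ) ⇒′ maps′ (suc (suc r)) i1 i0 ⇒′ i0 ∈′ suc (suc δ)))

module Theory {ℓ : Level} (em : ExcludedMiddle ℓ) (V : Set ℓ) (_∈_ : V → V → Set ℓ)
              (zfc : SetTheory.ZFC V _∈_) where

  open SetTheory V _∈_
  open ZFC zfc

  byContradiction : {P : Set ℓ} → ¬ ¬ P → P
  byContradiction {P} ¬¬p with em {P}
  ... | yes p = p
  ... | no ¬p = ⊥-elim (¬¬p ¬p)

  ⊆-antisym : ∀ {x y} → x ⊆ y → y ⊆ x → x ≡ y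
  ⊆-antisym x⊆y y⊆x = extensionality _ _ λ z → mk⇔ (x⊆y z) (y⊆x z)

  ¬⊆⇒∃ : ∀ {x y} → ¬ (x ⊆ y) → ∃[ z ] z ∈ x × ¬ (z ∈ y)
  ¬⊆⇒∃ x⊈y = byContradiction λ h →
    x⊈y λ z z∈x → byContradiction λ z∉y → h (z , z∈x , z∉y)

  -- Set-forming operations

  pair : V → V → V
  pair x y = proj₁ (pairing x y)

  pair-spec : ∀ x y → IsUnorderedPair (pair x y) x y
  pair-spec x y = proj₂ (pairing x y)

  ⟅_⟆ : V → V
  ⟅ x ⟆ = pair x x

  x∈⟅x⟆ : ∀ {x} → x ∈ ⟅ x ⟆
  x∈⟅x⟆ {x} = from (pair-spec x x _) (inj₁ refl)

  ∈⟅x⟆ : ∀ {x y} → y ∈ ⟅ x ⟆ → y ≡ x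
  ∈⟅x⟆ {x} y∈ = [ id , id ]′ (to (pair-spec x x _) y∈)

  ⋃ : V → V
  ⋃ x = proj₁ (union x)

  ⋃-spec : ∀ x z → z ∈ ⋃ x ⇔ (∃[ y ] y ∈ x × z ∈ y)
  ⋃-spec x = proj₂ (union x)

  ∈⋃ : ∀ {x y z} → y ∈ x → z ∈ y → z ∈ ⋃ x
  ∈⋃ y∈x z∈y = from (⋃-spec _ _) (_ , y∈x , z∈y)

  _∪_ : V → V → V
  x ∪ y = ⋃ (pair x y)

  ∪ˡ : ∀ {x y} → x ⊆ (x ∪ y)
  ∪ˡ z z∈x = ∈⋃ (from (pair-spec _ _ _) (inj₁ refl)) z∈x

  ∪ʳ : ∀ {x y} → y ⊆ (x ∪ y)
  ∪ʳ z z∈y = ∈⋃ (from (pair-spec _ _ _) (inj₂ refl)) z∈y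

  ∪-elim : ∀ {x y z} → z ∈ (x ∪ y) → z ∈ x ⊎ z ∈ y
  ∪-elim z∈ with to (⋃-spec _ _) z∈
  ... | _ , w∈ , z∈w with to (pair-spec _ _ _) w∈
  ... | inj₁ refl = inj₁ z∈w
  ... | inj₂ refl = inj₂ z∈w

  𝒫 : V → V
  𝒫 x = proj₁ (power x)

  𝒫-spec : ∀ x → IsPower (𝒫 x) x
  𝒫-spec x = proj₂ (power x)

  _∩_ : V → V → V
  x ∩ y = proj₁ (separation (i0 ∈′ i1) (y ∷ []) x)

  ∩-spec : ∀ x y → IsIntersection (x ∩ y) x y
  ∩-spec x y = proj₂ (separation (i0 ∈′ i1) (y ∷ []) x)

  ∈-minimal : ∀ {s} → Nonempty s → ∃[ y ] y ∈ s × (∀ z → z ∈ y → ¬ (z ∈ s))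
  ∈-minimal = foundation _

  ∈-irrefl : ∀ {x} → ¬ (x ∈ x)
  ∈-irrefl {x} x∈x with foundation ⟅ x ⟆ (x , x∈⟅x⟆)
  ... | y , y∈ , min with ∈⟅x⟆ y∈
  ... | refl = min _ x∈x x∈⟅x⟆

  ∈-asym : ∀ {x y} → x ∈ y → ¬ (y ∈ x)
  ∈-asym {x} {y} x∈y y∈x
    with foundation (pair x y) (x , from (pair-spec x y x) (inj₁ refl))
  ... | z , z∈ , min with to (pair-spec x y z) z∈
  ... | inj₁ refl = min y y∈x (from (pair-spec x y y) (inj₂ refl))
  ... | inj₂ refl = min x x∈y (from (pair-spec x y x) (inj₁ refl))

  -- Ordered pairs and relations

  orderedPair-exists : ∀ x y → ∃[ p ] IsOrderedPair p x y
  orderedPair-exists x y =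
    pair ⟅ x ⟆ (pair x y) ,
    ⟅ x ⟆ , pair x y , pair-spec x x , pair-spec x y , pair-spec _ _

  orderedPair-injective : ∀ {p x y x′ y′} →
    IsOrderedPair p x y → IsOrderedPair p x′ y′ → x ≡ x′ × y ≡ y′
  orderedPair-injective {p} {x} {y} {x′} {y′}
    (a , b , a-spec , b-spec , p-spec) (a′ , b′ , a′-spec , b′-spec , p-spec′) =
    x≡x′ , y≡y′
    where
    in-a : ∀ {z} → z ∈ a → z ≡ x
    in-a z∈a = [ id , id ]′ (to (a-spec _) z∈a)

    in-a′ : ∀ {z} → z ∈ a′ → z ≡ x′
    in-a′ z∈a′ = [ id , id ]′ (to (a′-spec _) z∈a′)

    x≡x′ : x ≡ x′
    x≡x′ with to (p-spec′ a) (from (p-spec a) (inj₁ refl))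
    ... | inj₁ refl = in-a′ (from (a-spec x) (inj₁ refl))
    ... | inj₂ refl = sym (in-a (from (b′-spec x′) (inj₁ refl)))

    y≡y′ : y ≡ y′
    y≡y′ with to (p-spec′ b) (from (p-spec b) (inj₂ refl))
    ... | inj₁ refl with to (p-spec b′) (from (p-spec′ b′) (inj₂ refl))
    ...   | inj₁ refl = trans (in-a′ (from (b-spec y) (inj₂ refl)))
                          (trans (sym x≡x′) (sym (in-a (from (b′-spec y′) (inj₂ refl)))))
    ...   | inj₂ refl = trans (in-a′ (from (b-spec y) (inj₂ refl)))
                          (sym (in-a′ (from (b′-spec y′) (inj₂ refl))))
    y≡y′ | inj₂ refl with to (b′-spec y) (from (b-spec y) (inj₂ refl))
    ...   | inj₂ y≡y′ = y≡y′
    ...   | inj₁ y≡x′ with to (b-spec y′) (from (b′-spec y′) (inj₂ refl))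
    ...     | inj₁ y′≡x = trans y≡x′ (trans (sym x≡x′) (sym y′≡x))
    ...     | inj₂ y′≡y = sym y′≡y

  orderedPair-∈𝒫𝒫 : ∀ {p x y a b} → x ∈ a → y ∈ b → IsOrderedPair p x y → p ∈ 𝒫 (𝒫 (a ∪ b))
  orderedPair-∈𝒫𝒫 {a = a} {b} x∈a y∈b (_ , _ , s-spec , t-spec , p-spec) =
    from (𝒫-spec _ _) λ q q∈p → from (𝒫-spec _ _) λ z z∈q → member (to (p-spec q) q∈p) z∈q
    where
    member : ∀ {q z} → _ → z ∈ q → z ∈ (a ∪ b)
    member (inj₁ refl) z∈q with to (s-spec _) z∈q
    ... | inj₁ refl = ∪ˡ _ x∈a
    ... | inj₂ refl = ∪ˡ _ x∈a
    member (inj₂ refl) z∈q with to (t-spec _) z∈q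
    ... | inj₁ refl = ∪ˡ _ x∈a
    ... | inj₂ refl = ∪ʳ _ y∈b

  -- The variable p, which φ must ignore, is the ordered pair being tested.
  relation : ∀ {n} (φ : Formula (suc (suc (suc (suc (suc n)))))) (ρ : Vec V n) a b
    (Q : V → V → Set ℓ) → (∀ p x y → Sat φ (x ∷ y ∷ p ∷ a ∷ b ∷ ρ) ≡ Q x y) →
    ∃[ f ] (∀ p → p ∈ f → ∃[ x ] ∃[ y ] x ∈ a × y ∈ b × IsOrderedPair p x y) ×
           (∀ x y → Maps f x y ⇔ (x ∈ a × y ∈ b × Q x y))
  relation φ ρ a b Q φ≡Q
    with separation (∃′ ∃′ (i0 ∈′ i3 ∧′ i1 ∈′ i4 ∧′ orderedPair′ i2 i0 i1 ∧′ φ))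
           (a ∷ b ∷ ρ) (𝒫 (𝒫 (a ∪ b)))
  ... | f , f-spec = f , pairs , λ x y → mk⇔ (maps⇒ x y) (⇒maps x y)
    where
    pairs : ∀ p → p ∈ f → ∃[ x ] ∃[ y ] x ∈ a × y ∈ b × IsOrderedPair p x y
    pairs p p∈f with to (f-spec p) p∈f
    ... | _ , y , x , x∈a , y∈b , p-pair , _ = x , y , x∈a , y∈b , p-pair

    maps⇒ : ∀ x y → Maps f x y → x ∈ a × y ∈ b × Q x y
    maps⇒ x y (p , p-pair , p∈f) with to (f-spec p) p∈f
    ... | _ , y′ , x′ , x∈a , y∈b , p-pair′ , sat with orderedPair-injective p-pair p-pair′
    ... | refl , refl = x∈a , y∈b , subst id (φ≡Q p x y) sat

    ⇒maps : ∀ x y → x ∈ a × y ∈ b × Q x y → Maps f x y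
    ⇒maps x y (x∈a , y∈b , q) with orderedPair-exists x y
    ... | p , p-pair = p , p-pair , from (f-spec p)
      (orderedPair-∈𝒫𝒫 x∈a y∈b p-pair ,
       y , x , x∈a , y∈b , p-pair , subst id (sym (φ≡Q p x y)) q)

  Functional : V → Set ℓ
  Functional r = ∀ x y z → Maps r x y → Maps r x z → y ≡ z

  -- `choice` selects from the members of a family of sets. The family here is the set of fibres of
  -- `r` over `a`, and `g` sends `x` to the element selected from its fibre.
  uniformize : ∀ r a b → (∀ x → x ∈ a → ∃[ y ] y ∈ b × Maps r x y) →
    ∃[ g ] (∀ x → x ∈ a → ∃[ y ] Maps g x y) × Functional g ×
           (∀ x y → Maps g x y → y ∈ b × Maps r x y)
  uniformize r a b total
    with separation (∃′ (i0 ∈′ i2 ∧′ ∀′ (i0 ∈′ i2 ⇔′ i0 ∈′ i4 ∧′ maps′ i5 i1 i0)))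
           (a ∷ b ∷ r ∷ []) (𝒫 b)
  ... | fibres , fibres-spec
    with choice fibres nonempty
    where
    nonempty : ∀ s → s ∈ fibres → Nonempty s
    nonempty s s∈ with to (fibres-spec s) s∈
    ... | _ , x , x∈a , s-spec with total x x∈a
    ... | y , y∈b , rxy = y , from (s-spec y) (y∈b , rxy)
  ... | f , _ , (f-pairs , f-total) , f-choice
    with relation (∃′ (∀′ (i0 ∈′ i1 ⇔′ i0 ∈′ i6 ∧′ maps′ i7 i2 i0) ∧′ maps′ i7 i0 i2))
           (r ∷ f ∷ []) a b
           (λ x y → ∃[ s ] (∀ z → z ∈ s ⇔ (z ∈ b × Maps r x z)) × Maps f s y)
           (λ _ _ _ → refl)
  ... | g , _ , g-spec = g , g-total , g-functional , g⊆r
    where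
    fibre : ∀ x → ∃[ s ] ∀ z → z ∈ s ⇔ (z ∈ b × Maps r x z)
    fibre x = separation (maps′ i1 i2 i0) (r ∷ x ∷ []) b

    fibre∈ : ∀ x → x ∈ a → proj₁ (fibre x) ∈ fibres
    fibre∈ x x∈a = from (fibres-spec _)
      (from (𝒫-spec b _) (λ z z∈s → proj₁ (to (proj₂ (fibre x) z) z∈s)) ,
       x , x∈a , proj₂ (fibre x))

    g-total : ∀ x → x ∈ a → ∃[ y ] Maps g x y
    g-total x x∈a with f-total _ (fibre∈ x x∈a)
    ... | y , fsy , _ = y , from (g-spec x y)
      (x∈a , proj₁ (to (proj₂ (fibre x) y) (f-choice _ y (fibre∈ x x∈a) fsy)) ,
       proj₁ (fibre x) , proj₂ (fibre x) , fsy)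

    at-fibre : ∀ x y → Maps g x y → x ∈ a × Maps f (proj₁ (fibre x)) y
    at-fibre x y gxy with to (g-spec x y) gxy
    ... | x∈a , _ , s , s-spec , fsy = x∈a , subst (λ s → Maps f s y) s≡ fsy
      where
      s≡ : s ≡ proj₁ (fibre x)
      s≡ = extensionality _ _ λ z →
        mk⇔ (from (proj₂ (fibre x) z) ∘ to (s-spec z)) (from (s-spec z) ∘ to (proj₂ (fibre x) z))

    g-functional : Functional g
    g-functional x y z gxy gxz with at-fibre x y gxy | at-fibre x z gxz
    ... | x∈a , fy | _ , fz with f-total _ (fibre∈ x x∈a)
    ... | _ , _ , unique = trans (unique y fy) (sym (unique z fz))

    g⊆r : ∀ x y → Maps g x y → y ∈ b × Maps r x y
    g⊆r x y gxy with at-fibre x y gxy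
    ... | x∈a , fy = to (proj₂ (fibre x) y) (f-choice _ y (fibre∈ x x∈a) fy)

  bijection : ∀ {a b} f →
    (∀ p → p ∈ f → ∃[ x ] ∃[ y ] x ∈ a × y ∈ b × IsOrderedPair p x y) →
    (∀ x → x ∈ a → ∃[ y ] Maps f x y) → Functional f →
    (∀ x x′ y → Maps f x y → Maps f x′ y → x ≡ x′) →
    (∀ y → y ∈ b → ∃[ x ] Maps f x y) → Equinumerous a b
  bijection f pairs total functional injective surjective =
    f , (pairs , λ x x∈a → let y , fxy = total x x∈a in
                 y , fxy , λ z fxz → functional x z y fxz fxy) ,
    injective , surjective

  function-∈ : ∀ {f a b x y} → IsFunction f a b → Maps f x y → x ∈ a × y ∈ b
  function-∈ (pairs , _) (p , p-pair , p∈f) with pairs p p∈f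
  ... | _ , _ , x∈a , y∈b , p-pair′ with orderedPair-injective p-pair p-pair′
  ... | refl , refl = x∈a , y∈b

  equinumerous-cancelʳ : ∀ {a b c} → Equinumerous a c → Equinumerous b c → Equinumerous a b
  equinumerous-cancelʳ {a} {b} {c}
    (f , f-fun@(_ , f-total) , f-inj , f-surj) (g , g-fun@(_ , g-total) , g-inj , g-surj)
    with relation (∃′ (i0 ∈′ i6 ∧′ maps′ i7 i1 i0 ∧′ maps′ i8 i2 i0)) (c ∷ f ∷ g ∷ []) a b
           (λ x y → ∃[ z ] z ∈ c × Maps f x z × Maps g y z) (λ _ _ _ → refl)
  ... | h , h-pairs , h-spec = bijection h h-pairs
    (λ x x∈a → let z , fxz , _ = f-total x x∈a
                   z∈c = proj₂ (function-∈ f-fun fxz)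
                   y , gyz = g-surj z z∈c
               in y , from (h-spec x y) (x∈a , proj₁ (function-∈ g-fun gyz) , z , z∈c , fxz , gyz))
    (λ x y y′ hxy hxy′ → functional x y y′ (to (h-spec x y) hxy) (to (h-spec x y′) hxy′))
    (λ x x′ y hxy hx′y → injective x x′ y (to (h-spec x y) hxy) (to (h-spec x′ y) hx′y))
    (λ y y∈b → let z , gyz , _ = g-total y y∈b
                   z∈c = proj₂ (function-∈ g-fun gyz)
                   x , fxz = f-surj z z∈c
               in x , from (h-spec x y) (proj₁ (function-∈ f-fun fxz) , y∈b , z , z∈c , fxz , gyz))
    where
    functional : ∀ x y y′ → _ → _ → y ≡ y′
    functional x y y′ (_ , _ , z , _ , fxz , gyz) (_ , _ , z′ , _ , fxz′ , gy′z′)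
      with f-total x (proj₁ (function-∈ f-fun fxz))
    ... | _ , _ , unique with trans (unique z fxz) (sym (unique z′ fxz′))
    ... | refl = g-inj y y′ z gyz gy′z′

    injective : ∀ x x′ y → _ → _ → x ≡ x′
    injective x x′ y (_ , _ , z , _ , fxz , gyz) (_ , _ , z′ , _ , fx′z′ , gyz′)
      with g-total y (proj₁ (function-∈ g-fun gyz))
    ... | _ , _ , unique with trans (unique z gyz) (sym (unique z′ gyz′))
    ... | refl = f-inj x x′ z fxz fx′z′

  -- Ordinals

  ≤ₒ⇒∌ : ∀ {α β} → α ≤ₒ β → ¬ (β ∈ α)
  ≤ₒ⇒∌ (inj₁ α∈β) β∈α = ∈-asym α∈β β∈α
  ≤ₒ⇒∌ (inj₂ refl) β∈α = ∈-irrefl β∈α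

  least : ∀ {n} (φ : Formula (suc n)) (ρ : Vec V n) (Q : V → Set ℓ) →
    (∀ x → Sat φ (x ∷ ρ) ≡ Q x) → ∀ {a x} → x ∈ a → Q x →
    ∃[ m ] m ∈ a × Q m × (∀ y → y ∈ m → y ∈ a → ¬ Q y)
  least φ ρ Q φ≡Q {a} {x} x∈a qx with separation φ ρ a
  ... | s , s-spec with ∈-minimal (x , from (s-spec x) (x∈a , subst id (sym (φ≡Q x)) qx))
  ... | m , m∈s , minimal with to (s-spec m) m∈s
  ... | m∈a , sat = m , m∈a , subst id (φ≡Q m) sat ,
    λ y y∈m y∈a qy → minimal y y∈m (from (s-spec y) (y∈a , subst id (sym (φ≡Q y)) qy))

  module _ {κ : V} (κ-ord : Ordinal κ) where

    transitive : ∀ {α β} → α ∈ κ → β ∈ α → β ∈ κ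
    transitive α∈κ β∈α = proj₁ κ-ord _ α∈κ _ β∈α

    ∈-trans : ∀ {α β γ} → γ ∈ κ → α ∈ β → β ∈ γ → α ∈ γ
    ∈-trans γ∈κ α∈β β∈γ = let _ , trans-∈ , _ = proj₂ κ-ord in
      trans-∈ _ _ _ (transitive (transitive γ∈κ β∈γ) α∈β) (transitive γ∈κ β∈γ) γ∈κ α∈β β∈γ

    trichotomy : ∀ {α β} → α ∈ κ → β ∈ κ → α ∈ β ⊎ α ≡ β ⊎ β ∈ α
    trichotomy α∈κ β∈κ = let _ , _ , tri , _ = proj₂ κ-ord in tri _ _ α∈κ β∈κ

    element-ordinal : ∀ {α} → α ∈ κ → Ordinal α
    element-ordinal {α} α∈κ =
      (λ β β∈α γ γ∈β → ∈-trans α∈κ γ∈β β∈α) ,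
      (λ _ _ → ∈-irrefl) ,
      (λ _ _ _ _ _ δ∈α β∈γ γ∈δ → ∈-trans (transitive α∈κ δ∈α) β∈γ γ∈δ) ,
      (λ _ _ β∈α γ∈α → trichotomy (transitive α∈κ β∈α) (transitive α∈κ γ∈α)) ,
      (λ s s⊆α → let _ , _ , _ , min = proj₂ κ-ord in
                 min s λ z z∈s → transitive α∈κ (s⊆α z z∈s))

    ∌⇒≤ₒ : ∀ {α β} → α ∈ κ → β ∈ κ → ¬ (β ∈ α) → α ≤ₒ β
    ∌⇒≤ₒ α∈κ β∈κ β∉α with trichotomy α∈κ β∈κ
    ... | inj₁ α∈β = inj₁ α∈β
    ... | inj₂ (inj₁ α≡β) = inj₂ α≡β
    ... | inj₂ (inj₂ β∈α) = ⊥-elim (β∉α β∈α)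

    ≤ₒ-∈-trans : ∀ {α β γ} → γ ∈ κ → α ≤ₒ β → β ∈ γ → α ∈ γ
    ≤ₒ-∈-trans γ∈κ (inj₁ α∈β) β∈γ = ∈-trans γ∈κ α∈β β∈γ
    ≤ₒ-∈-trans γ∈κ (inj₂ refl) β∈γ = β∈γ

    common-bound : ∀ {α β} → α ∈ κ → β ∈ κ → ∃[ γ ] γ ∈ κ × α ⊆ γ × β ⊆ γ
    common-bound {α} {β} α∈κ β∈κ with trichotomy α∈κ β∈κ
    ... | inj₁ α∈β = β , β∈κ , (λ ζ ζ∈α → ∈-trans β∈κ ζ∈α α∈β) , (λ _ → id)
    ... | inj₂ (inj₁ refl) = α , α∈κ , (λ _ → id) , (λ _ → id)
    ... | inj₂ (inj₂ β∈α) = α , α∈κ , (λ _ → id) , (λ ζ ζ∈β → ∈-trans α∈κ ζ∈β β∈α)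

    -- The least element of `κ` missing from `s`, if there is one, equals `s`.
    initialSegment : ∀ {s} → s ⊆ κ → (∀ {α β} → α ∈ s → β ∈ α → β ∈ s) → s ≡ κ ⊎ s ∈ κ
    initialSegment {s} s⊆κ down with em {κ ⊆ s}
    ... | yes κ⊆s = inj₁ (⊆-antisym s⊆κ κ⊆s)
    ... | no κ⊈s with ¬⊆⇒∃ κ⊈s
    ... | α , α∈κ , α∉s with least (¬′ (i0 ∈′ i1)) (s ∷ []) (λ β → ¬ (β ∈ s)) (λ _ → refl) α∈κ α∉s
    ... | m , m∈κ , m∉s , minimal = inj₂ (subst (_∈ κ) (sym (⊆-antisym s⊆m m⊆s)) m∈κ)
      where
      m⊆s : m ⊆ s
      m⊆s β β∈m = byContradiction (minimal β β∈m (transitive m∈κ β∈m))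

      s⊆m : s ⊆ m
      s⊆m β β∈s with trichotomy (s⊆κ β β∈s) m∈κ
      ... | inj₁ β∈m = β∈m
      ... | inj₂ (inj₁ refl) = ⊥-elim (m∉s β∈s)
      ... | inj₂ (inj₂ m∈β) = ⊥-elim (m∉s (down β∈s m∈β))

  -- Smallness, |x| < κ, in a form that involves no cardinals

  infix 4 _≼_

  -- An injection weakened to a total relation with disjoint sets of values. One `f` then serves all
  -- subsets of `x`, and codings such as those of `small-𝒫` and `few-avoid` can be used as they
  -- come.
  _≼_ : V → V → Set ℓ
  x ≼ y = ∃[ f ] (∀ a → a ∈ x → ∃[ b ] b ∈ y × Maps f a b) ×
                 (∀ a a′ b → Maps f a b → Maps f a′ b → a ≡ a′)

  Small : V → V → Set ℓ
  Small κ x = ∃[ α ] α ∈ κ × x ≼ α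

  Bounded : V → V → V → Set ℓ
  Bounded κ r x = ∃[ δ ] δ ∈ κ × (∀ i → i ∈ x → ∀ ζ → ζ ∈ κ → Maps r i ζ → ζ ∈ δ)

  ≼-⊆ : ∀ {x y α} → x ⊆ y → y ≼ α → x ≼ α
  ≼-⊆ x⊆y (f , total , injective) = f , (λ a a∈x → total a (x⊆y a a∈x)) , injective

  small-⊆ : ∀ {κ x y} → x ⊆ y → Small κ y → Small κ x
  small-⊆ x⊆y (α , α∈κ , y≼α) = α , α∈κ , ≼-⊆ x⊆y y≼α

  size⇒small : ∀ {κ x} → ∣ x ∣< κ → Small κ x
  size⇒small (μ , (_ , f , f-fun@(_ , f-total) , f-inj , _) , μ∈κ) =
    μ , μ∈κ , f ,
    (λ a a∈x → let b , fab , _ = f-total a a∈x in b , proj₂ (function-∈ f-fun fab) , fab) , f-inj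

  module _ {κ : V} (κ-reg : Regular κ) where

    private
      κ-ord : Ordinal κ
      κ-ord = proj₁ (proj₁ κ-reg)

    upperBound : ∀ {α} → α ∈ κ → ∃[ β ] β ∈ κ × α ∈ β
    upperBound = let _ , (_ , _ , limit) , _ = κ-reg in limit _

    -- Along `x ≼ α`, let `g` send `ξ` to the least bound of the `r`-values of the element coded by
    -- `ξ`. If `r` were unbounded on `x`, then `g` would be cofinal from `α` to `κ`, against
    -- regularity.
    small⇒boundedRange : ∀ {x} r → Small κ x →
      (∀ i → i ∈ x → ∃[ δ ] δ ∈ κ × (∀ ζ → ζ ∈ κ → Maps r i ζ → ζ ∈ δ)) → Bounded κ r x
    small⇒boundedRange {x} r (α , α∈κ , f , f-total , f-inj) fibre-bounded =
      byContradiction λ unbounded →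
        let _ , _ , not-cofinal = κ-reg in
        not-cofinal α α∈κ (g , (proj₁ (proj₂ g-relation) , g-total) , cofinal unbounded)
      where
      Bound : V → V → Set ℓ
      Bound ξ δ = ∀ i → i ∈ x → Maps f i ξ → ∀ ζ → ζ ∈ κ → Maps r i ζ → ζ ∈ δ

      g-relation = relation (bound′ i5 i6 i7 i4 i0 i1 ∧′ ∀′ (i0 ∈′ i2 ⇒′ ¬′ bound′ i6 i7 i8 i5 i1 i0))
        (x ∷ f ∷ r ∷ []) α κ
        (λ ξ δ → Bound ξ δ × (∀ δ′ → δ′ ∈ δ → ¬ Bound ξ δ′)) (λ _ _ _ → refl)

      g : V
      g = proj₁ g-relation

      g-spec : ∀ ξ δ →
        Maps g ξ δ ⇔ (ξ ∈ α × δ ∈ κ × Bound ξ δ × (∀ δ′ → δ′ ∈ δ → ¬ Bound ξ δ′))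
      g-spec = proj₂ (proj₂ g-relation)

      bound : ∀ ξ → ∃[ δ ] δ ∈ κ × Bound ξ δ
      bound ξ with em {∃[ i ] i ∈ x × Maps f i ξ}
      -- If `ξ` codes nothing, any element of `κ` is a bound.
      ... | no ¬i = let _ , (_ , (δ , δ∈κ) , _) , _ = κ-reg in
                    δ , δ∈κ , λ i i∈x fiξ → ⊥-elim (¬i (i , i∈x , fiξ))
      ... | yes (i , i∈x , fiξ) with fibre-bounded i i∈x
      ... | δ , δ∈κ , below = δ , δ∈κ , λ i′ _ fi′ξ ζ ζ∈κ ri′ζ →
        below ζ ζ∈κ (subst (λ i → Maps r i ζ) (f-inj i′ i ξ fi′ξ fiξ) ri′ζ)

      g-total : ∀ ξ → ξ ∈ α → ∃[ δ ] Maps g ξ δ × (∀ δ′ → Maps g ξ δ′ → δ′ ≡ δ)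
      g-total ξ ξ∈α with bound ξ
      ... | δ₀ , δ₀∈κ , bound₀
        with least (bound′ i1 i2 i3 i4 i5 i0) (x ∷ f ∷ r ∷ κ ∷ ξ ∷ []) (Bound ξ) (λ _ → refl)
               δ₀∈κ bound₀
      ... | δ , δ∈κ , bδ , minimal =
        δ , from (g-spec ξ δ) (ξ∈α , δ∈κ , bδ , λ δ′ δ′∈δ → minimal δ′ δ′∈δ (transitive κ-ord δ∈κ δ′∈δ)) ,
        unique
        where
        unique : ∀ δ′ → Maps g ξ δ′ → δ′ ≡ δ
        unique δ′ gξδ′ with to (g-spec ξ δ′) gξδ′
        ... | _ , δ′∈κ , bδ′ , minimal′ with trichotomy κ-ord δ′∈κ δ∈κ
        ... | inj₁ δ′∈δ = ⊥-elim (minimal δ′ δ′∈δ δ′∈κ bδ′)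
        ... | inj₂ (inj₁ δ′≡δ) = δ′≡δ
        ... | inj₂ (inj₂ δ∈δ′) = ⊥-elim (minimal′ δ δ∈δ′ bδ)

      cofinal : ¬ Bounded κ r x → ∀ γ → γ ∈ κ →
        ∃[ ξ ] ∃[ δ ] ξ ∈ α × Maps g ξ δ × γ ≤ₒ δ
      cofinal unbounded γ γ∈κ = byContradiction λ none →
        unbounded (γ , γ∈κ , λ i i∈x ζ ζ∈κ riζ →
          let ξ , ξ∈α , fiξ = f-total i i∈x
              δ , gξδ , _ = g-total ξ ξ∈α
              _ , δ∈κ , bδ , _ = to (g-spec ξ δ) gξδ
              ζ∈δ = bδ i i∈x fiξ ζ ζ∈κ riζ
          in case trichotomy κ-ord ζ∈κ γ∈κ of λ where
               (inj₁ ζ∈γ) → ζ∈γ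
               (inj₂ (inj₁ refl)) → ⊥-elim (none (ξ , δ , ξ∈α , gξδ , inj₁ ζ∈δ))
               (inj₂ (inj₂ γ∈ζ)) →
                 ⊥-elim (none (ξ , δ , ξ∈α , gξδ , inj₁ (∈-trans κ-ord δ∈κ γ∈ζ ζ∈δ))))

    small⇒bounded : ∀ {x} r → Functional r → Small κ x → Bounded κ r x
    small⇒bounded r functional x-small = small⇒boundedRange r x-small λ i _ →
      case em {∃[ ζ ] ζ ∈ κ × Maps r i ζ} of λ where
        (no ¬ζ) → let _ , (_ , (δ , δ∈κ) , _) , _ = κ-reg in
                  δ , δ∈κ , λ ζ ζ∈κ riζ → ⊥-elim (¬ζ (ζ , ζ∈κ , riζ))
        (yes (ζ , ζ∈κ , riζ)) → let δ , δ∈κ , ζ∈δ = upperBound ζ∈κ in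
          δ , δ∈κ , λ ζ′ _ riζ′ → subst (_∈ δ) (functional i ζ ζ′ riζ riζ′) ζ∈δ

  -- Smallness for subsets of an ambient ordinal `Ω`, which well-orders them all

  module WithinOrdinal (Ω : V) (Ω-ord : Ordinal Ω) where

    -- Bisimilarity relates the elements of x and κ of equal rank, so that one of the
    -- two well-orders is isomorphic to an initial segment of the other.
    comparison : ∀ {x κ} → x ⊆ Ω → Ordinal κ →
      ∃[ j ] Functional j × (∀ a a′ ξ → Maps j a ξ → Maps j a′ ξ → a ≡ a′) ×
        (∀ a ξ → Maps j a ξ → a ∈ x × ξ ∈ κ) ×
        (∀ a ξ η → Maps j a ξ → η ∈ ξ → ∃[ b ] Maps j b η) ×
        ((∀ a → a ∈ x → ∃[ ξ ] Maps j a ξ) ⊎ (∀ ξ → ξ ∈ κ → ∃[ a ] Maps j a ξ))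
    comparison {x} {κ} x⊆Ω κ-ord =
      j , functional , injective , j-⊆ ,
      (λ a ξ η jaξ η∈ξ → let b , _ , _ , jbη = j-back jaξ η∈ξ in b , jbη) , dichotomy
      where
      Bisimulation : V → Set ℓ
      Bisimulation r = ∀ a ξ → Maps r a ξ →
        (∀ b → b ∈ x → b ∈ a → ∃[ η ] η ∈ ξ × Maps r b η) ×
        (∀ η → η ∈ ξ → ∃[ b ] b ∈ x × b ∈ a × Maps r b η)

      j-relation = relation (∃′ (bisimulation′ i4 i0 ∧′ maps′ i0 i1 i2)) [] x κ
        (λ a ξ → ∃[ r ] Bisimulation r × Maps r a ξ) (λ _ _ _ → refl)

      j : V
      j = proj₁ j-relation

      j-spec : ∀ a ξ → Maps j a ξ ⇔ (a ∈ x × ξ ∈ κ × (∃[ r ] Bisimulation r × Maps r a ξ))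
      j-spec = proj₂ (proj₂ j-relation)

      j-⊆ : ∀ a ξ → Maps j a ξ → a ∈ x × ξ ∈ κ
      j-⊆ a ξ jaξ = let a∈x , ξ∈κ , _ = to (j-spec a ξ) jaξ in a∈x , ξ∈κ

      j-forth : ∀ {a ξ b} → Maps j a ξ → b ∈ x → b ∈ a → ∃[ η ] η ∈ ξ × Maps j b η
      j-forth {a} {ξ} {b} jaξ b∈x b∈a with to (j-spec a ξ) jaξ
      ... | _ , ξ∈κ , r , r-bisim , raξ with proj₁ (r-bisim a ξ raξ) b b∈x b∈a
      ... | η , η∈ξ , rbη =
        η , η∈ξ , from (j-spec b η) (b∈x , transitive κ-ord ξ∈κ η∈ξ , r , r-bisim , rbη)

      j-back : ∀ {a ξ η} → Maps j a ξ → η ∈ ξ → ∃[ b ] b ∈ x × b ∈ a × Maps j b η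
      j-back {a} {ξ} {η} jaξ η∈ξ with to (j-spec a ξ) jaξ
      ... | _ , ξ∈κ , r , r-bisim , raξ with proj₂ (r-bisim a ξ raξ) η η∈ξ
      ... | b , b∈x , b∈a , rbη =
        b , b∈x , b∈a , from (j-spec b η) (b∈x , transitive κ-ord ξ∈κ η∈ξ , r , r-bisim , rbη)

      -- Descent on `a`: going back from the pair with the larger value reaches some `b ∈ a` with
      -- value `ξ`, and going forth from the pair with value `ξ` gives this `b` a second value,
      -- below `ξ`.
      no-two-values : ∀ a ξ η → Maps j a ξ → Maps j a η → ¬ (ξ ∈ η)
      no-two-values a ξ η jaξ jaη ξ∈η
        with least (∃′ ∃′ (maps′ i3 i2 i1 ∧′ maps′ i3 i2 i0 ∧′ i1 ∈′ i0)) (j ∷ [])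
               (λ a → ∃[ ξ ] ∃[ η ] Maps j a ξ × Maps j a η × ξ ∈ η) (λ _ → refl)
               (proj₁ (j-⊆ a ξ jaξ)) (ξ , η , jaξ , jaη , ξ∈η)
      ... | a′ , _ , (ξ′ , η′ , ja′ξ′ , ja′η′ , ξ′∈η′) , minimal with j-back ja′η′ ξ′∈η′
      ... | b , b∈x , b∈a′ , jbξ′ with j-forth ja′ξ′ b∈x b∈a′
      ... | ζ , ζ∈ξ′ , jbζ = minimal b b∈a′ b∈x (ζ , ξ′ , jbζ , jbξ′ , ζ∈ξ′)

      functional : Functional j
      functional a ξ η jaξ jaη
        with trichotomy κ-ord (proj₂ (j-⊆ a ξ jaξ)) (proj₂ (j-⊆ a η jaη))
      ... | inj₁ ξ∈η = ⊥-elim (no-two-values a ξ η jaξ jaη ξ∈η)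
      ... | inj₂ (inj₁ ξ≡η) = ξ≡η
      ... | inj₂ (inj₂ η∈ξ) = ⊥-elim (no-two-values a η ξ jaη jaξ η∈ξ)

      not-below : ∀ a a′ ξ → Maps j a ξ → Maps j a′ ξ → ¬ (a ∈ a′)
      not-below a a′ ξ jaξ ja′ξ a∈a′ with j-forth ja′ξ (proj₁ (j-⊆ a ξ jaξ)) a∈a′
      ... | η , η∈ξ , jaη = no-two-values a η ξ jaη jaξ η∈ξ

      injective : ∀ a a′ ξ → Maps j a ξ → Maps j a′ ξ → a ≡ a′
      injective a a′ ξ jaξ ja′ξ
        with trichotomy Ω-ord (x⊆Ω a (proj₁ (j-⊆ a ξ jaξ))) (x⊆Ω a′ (proj₁ (j-⊆ a′ ξ ja′ξ)))
      ... | inj₁ a∈a′ = ⊥-elim (not-below a a′ ξ jaξ ja′ξ a∈a′)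
      ... | inj₂ (inj₁ a≡a′) = a≡a′
      ... | inj₂ (inj₂ a′∈a) = ⊥-elim (not-below a′ a ξ ja′ξ jaξ a′∈a)

      -- The least elements missed on the two sides are bisimilar.
      no-two-missing : ∀ {a ξ} → a ∈ x → ¬ (∃[ η ] Maps j a η) →
        ξ ∈ κ → ¬ (∃[ b ] Maps j b ξ) → ⊥
      no-two-missing a∈x a∉ ξ∈κ ξ∉
        with least (¬′ ∃′ maps′ i2 i1 i0) (j ∷ []) (λ a → ¬ (∃[ η ] Maps j a η)) (λ _ → refl) a∈x a∉
           | least (¬′ ∃′ maps′ i2 i0 i1) (j ∷ []) (λ ξ → ¬ (∃[ b ] Maps j b ξ)) (λ _ → refl) ξ∈κ ξ∉
      ... | a₀ , a₀∈x , a₀∉ , a₀-minimal | ξ₀ , ξ₀∈κ , ξ₀∉ , ξ₀-minimal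
        with relation (maps′ i5 i0 i1 ∨′ i0 ≐ i6 ∧′ i1 ≐ i7) (j ∷ a₀ ∷ ξ₀ ∷ []) x κ
               (λ a ξ → Maps j a ξ ⊎ (a ≡ a₀ × ξ ≡ ξ₀)) (λ _ _ _ → refl)
      ... | r , _ , r-spec =
        a₀∉ (ξ₀ , from (j-spec a₀ ξ₀) (a₀∈x , ξ₀∈κ , r , r-bisim ,
                    from (r-spec a₀ ξ₀) (a₀∈x , ξ₀∈κ , inj₂ (refl , refl))))
        where
        j⊆r : ∀ {a ξ} → Maps j a ξ → Maps r a ξ
        j⊆r {a} {ξ} jaξ = let a∈x , ξ∈κ = j-⊆ a ξ jaξ in
          from (r-spec a ξ) (a∈x , ξ∈κ , inj₁ jaξ)

        r-bisim : Bisimulation r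
        r-bisim a ξ raξ with to (r-spec a ξ) raξ
        ... | _ , _ , inj₁ jaξ =
          (λ b b∈x b∈a → let η , η∈ξ , jbη = j-forth jaξ b∈x b∈a in η , η∈ξ , j⊆r jbη) ,
          (λ η η∈ξ → let b , b∈x , b∈a , jbη = j-back jaξ η∈ξ in b , b∈x , b∈a , j⊆r jbη)
        ... | _ , _ , inj₂ (refl , refl) = forth , back
          where
          forth : ∀ b → b ∈ x → b ∈ a₀ → ∃[ η ] η ∈ ξ₀ × Maps r b η
          forth b b∈x b∈a₀ with byContradiction (a₀-minimal b b∈a₀ b∈x)
          ... | η , jbη with trichotomy κ-ord (proj₂ (j-⊆ b η jbη)) ξ₀∈κ
          ... | inj₁ η∈ξ₀ = η , η∈ξ₀ , j⊆r jbη
          ... | inj₂ (inj₁ refl) = ⊥-elim (ξ₀∉ (b , jbη))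
          ... | inj₂ (inj₂ ξ₀∈η) = let c , _ , _ , jcξ₀ = j-back jbη ξ₀∈η in
                                   ⊥-elim (ξ₀∉ (c , jcξ₀))

          back : ∀ η → η ∈ ξ₀ → ∃[ b ] b ∈ x × b ∈ a₀ × Maps r b η
          back η η∈ξ₀ with byContradiction (ξ₀-minimal η η∈ξ₀ (transitive κ-ord ξ₀∈κ η∈ξ₀))
          ... | b , jbη with j-⊆ b η jbη
          ... | b∈x , _ with trichotomy Ω-ord (x⊆Ω b b∈x) (x⊆Ω a₀ a₀∈x)
          ... | inj₁ b∈a₀ = b , b∈x , b∈a₀ , j⊆r jbη
          ... | inj₂ (inj₁ refl) = ⊥-elim (a₀∉ (η , jbη))
          ... | inj₂ (inj₂ a₀∈b) = let ζ , _ , ja₀ζ = j-forth jbη a₀∈x a₀∈b in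
                                   ⊥-elim (a₀∉ (ζ , ja₀ζ))

      dichotomy : (∀ a → a ∈ x → ∃[ ξ ] Maps j a ξ) ⊎ (∀ ξ → ξ ∈ κ → ∃[ a ] Maps j a ξ)
      dichotomy with em {∀ a → a ∈ x → ∃[ ξ ] Maps j a ξ}
      ... | yes total = inj₁ total
      ... | no ¬total = inj₂ λ ξ ξ∈κ → byContradiction λ ξ∉ →
        ¬total λ a a∈x → byContradiction λ a∉ → no-two-missing a∈x a∉ ξ∈κ ξ∉

    -- Collapsing bounded sets; unions of small sets

    module _ {κ : V} (κ-reg : Regular κ) where

      private
        κ-ord : Ordinal κ
        κ-ord = proj₁ (proj₁ κ-reg)

      -- Boundedness, applied to the comparison map `j`, leaves some `δ ∈ κ` outside its range. So
      -- `j` does not exhaust `κ`, must be total on `x`, and has a proper initial segment of `κ` as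
      -- its range.
      bounded⇒collapse : ∀ {x} → x ⊆ Ω → (∀ r → Functional r → Bounded κ r x) →
        ∃[ β ] β ∈ κ × Equinumerous x β
      bounded⇒collapse {x} x⊆Ω bounded =
        let j , functional , injective , j-⊆ , j-initial , dichotomy = comparison x⊆Ω κ-ord
            δ , δ∈κ , below = bounded j functional
            β , β-spec = separation (∃′ maps′ i2 i0 i1) (j ∷ []) κ
            δ∉range : ¬ (∃[ a ] Maps j a δ)
            δ∉range = λ where
              (a , jaδ) → ∈-irrefl (below a (proj₁ (j-⊆ a δ jaδ)) δ δ∈κ jaδ)
            β∈κ : β ∈ κ
            β∈κ = [ (λ β≡κ → ⊥-elim (δ∉range (proj₂ (to (β-spec δ) (subst (δ ∈_) (sym β≡κ) δ∈κ)))))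
                  , id ]′ (initialSegment κ-ord (λ ξ ξ∈β → proj₁ (to (β-spec ξ) ξ∈β))
                    λ {ξ} {η} ξ∈β η∈ξ →
                      let ξ∈κ , a , jaξ = to (β-spec ξ) ξ∈β in
                      from (β-spec η) (transitive κ-ord ξ∈κ η∈ξ , j-initial a ξ η jaξ η∈ξ))
            total : ∀ a → a ∈ x → ∃[ ξ ] Maps j a ξ
            total = [ id , (λ onto → ⊥-elim (δ∉range (onto δ δ∈κ))) ]′ dichotomy
            f , f-pairs , f-spec = relation (maps′ i5 i0 i1) (j ∷ []) x β (Maps j) (λ _ _ _ → refl)
            f⊆j : ∀ {a ξ} → Maps f a ξ → Maps j a ξ
            f⊆j = λ {a} {ξ} faξ → proj₂ (proj₂ (to (f-spec a ξ) faξ))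
        in β , β∈κ , bijection f f-pairs
          (λ a a∈x → let ξ , jaξ = total a a∈x in
            ξ , from (f-spec a ξ) (a∈x , from (β-spec ξ) (proj₂ (j-⊆ a ξ jaξ) , a , jaξ) , jaξ))
          (λ a ξ η faξ faη → functional a ξ η (f⊆j faξ) (f⊆j faη))
          (λ a b ξ faξ fbξ → injective a b ξ (f⊆j faξ) (f⊆j fbξ))
          (λ ξ ξ∈β → let _ , a , jaξ = to (β-spec ξ) ξ∈β in
            a , from (f-spec a ξ) (proj₁ (j-⊆ a ξ jaξ) , ξ∈β , jaξ))

      bounded⇒size : ∀ {x} → x ⊆ Ω → (∀ r → Functional r → Bounded κ r x) → ∣ x ∣< κ
      bounded⇒size {x} x⊆Ω bounded =
        let β , β∈κ , x≈β = bounded⇒collapse x⊆Ω bounded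
            μ , μ∈κ , x≈μ , minimal =
              least (∃′ bijection′ i0 i2 i1) (x ∷ []) (Equinumerous x) (λ _ → refl) β∈κ x≈β
        in μ , ((element-ordinal κ-ord μ∈κ , λ α α∈μ α≈μ →
             minimal α α∈μ (transitive κ-ord μ∈κ α∈μ) (equinumerous-cancelʳ x≈μ α≈μ)) , x≈μ) , μ∈κ

      small⇒size : ∀ {x} → x ⊆ Ω → Small κ x → ∣ x ∣< κ
      small⇒size x⊆Ω x-small =
        bounded⇒size x⊆Ω λ r functional → small⇒bounded κ-reg r functional x-small

      -- With `small⇒bounded` this characterises smallness by partial functions into `κ`. Closure of
      -- smallness under unions thereby reduces to bounding ordinals, in place of cardinal
      -- arithmetic.
      bounded⇒small : ∀ {x} → x ⊆ Ω → (∀ r → Functional r → Bounded κ r x) → Small κ x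
      bounded⇒small x⊆Ω bounded = size⇒small (bounded⇒size x⊆Ω bounded)

      small-⟅⟆ : ∀ {a} → a ∈ Ω → Small κ ⟅ a ⟆
      small-⟅⟆ {a} a∈Ω = bounded⇒small (λ b b∈ → subst (_∈ Ω) (sym (∈⟅x⟆ b∈)) a∈Ω) λ r functional →
        case em {∃[ ζ ] ζ ∈ κ × Maps r a ζ} of λ where
          (no ¬ζ) → let _ , (_ , (δ , δ∈κ) , _) , _ = κ-reg in
            δ , δ∈κ , λ b b∈ ζ ζ∈κ rbζ →
              ⊥-elim (¬ζ (ζ , ζ∈κ , subst (λ b → Maps r b ζ) (∈⟅x⟆ b∈) rbζ))
          (yes (ζ , ζ∈κ , raζ)) → let δ , δ∈κ , ζ∈δ = upperBound κ-reg ζ∈κ in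
            δ , δ∈κ , λ b b∈ ζ′ _ rbζ′ →
              subst (_∈ δ) (functional a ζ ζ′ raζ (subst (λ b → Maps r b ζ′) (∈⟅x⟆ b∈) rbζ′)) ζ∈δ

      small-⊎ : ∀ {x y z} → z ⊆ Ω → (∀ a → a ∈ z → a ∈ x ⊎ a ∈ y) →
        Small κ x → Small κ y → Small κ z
      small-⊎ {z = z} z⊆Ω cover x-small y-small = bounded⇒small z⊆Ω bounded
        where
        bounded : ∀ r → Functional r → Bounded κ r z
        bounded r functional =
          let δ , δ∈κ , x-below = small⇒bounded κ-reg r functional x-small
              ε , ε∈κ , y-below = small⇒bounded κ-reg r functional y-small
              μ , μ∈κ , δ⊆μ , ε⊆μ = common-bound κ-ord δ∈κ ε∈κ
          in μ , μ∈κ , λ a a∈z ζ ζ∈κ raζ →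
            [ (λ a∈x → δ⊆μ ζ (x-below a a∈x ζ ζ∈κ raζ))
            , (λ a∈y → ε⊆μ ζ (y-below a a∈y ζ ζ∈κ raζ)) ]′ (cover a a∈z)

      -- Composing `q` with a partial function into `κ` gives a relation on `I`. Its fibres are
      -- bounded because those of `q` lie in small sets, so regularity bounds the whole range.
      small-⋃ : ∀ {I z} q → Small κ I →
        (∀ i → i ∈ I → ∃[ y ] Small κ y × (∀ a → Maps q i a → a ∈ y)) →
        z ⊆ Ω → (∀ a → a ∈ z → ∃[ i ] i ∈ I × Maps q i a) → Small κ z
      small-⋃ {I} {z} q I-small fibre-small z⊆Ω cover = bounded⇒small z⊆Ω bounded
        where
        bounded : ∀ r → Functional r → Bounded κ r z
        bounded r functional =
          let s , _ , s-spec =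
                relation (∃′ (maps′ i6 i1 i0 ∧′ maps′ i7 i0 i2)) (q ∷ r ∷ []) I κ
                  (λ i ζ → ∃[ a ] Maps q i a × Maps r a ζ) (λ _ _ _ → refl)
              δ , δ∈κ , below = small⇒boundedRange κ-reg s I-small λ i i∈I →
                let y , y-small , fibre⊆y = fibre-small i i∈I
                    δ , δ∈κ , below = small⇒bounded κ-reg r functional y-small
                in δ , δ∈κ , λ ζ ζ∈κ siζ →
                  let _ , _ , a , qia , raζ = to (s-spec i ζ) siζ in
                  below a (fibre⊆y a qia) ζ ζ∈κ raζ
          in δ , δ∈κ , λ a a∈z ζ ζ∈κ raζ →
            let i , i∈I , qia = cover a a∈z in
            below i i∈I ζ ζ∈κ (from (s-spec i ζ) (i∈I , ζ∈κ , a , qia , raζ))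

    small-𝒫 : ∀ {κ x} → Regular κ → StrongLimit κ → x ⊆ Ω → Small κ x → Small κ (𝒫 x)
    small-𝒫 {κ} {x} κ-reg (_ , strong) x⊆Ω x-small =
      let ν , (ν-card , f , f-fun@(_ , f-total) , f-inj , _) , ν∈κ = small⇒size κ-reg x⊆Ω x-small
          θ , (_ , g , g-fun@(_ , g-total) , g-inj , _) , θ∈κ = strong ν ν∈κ ν-card (𝒫 ν) (𝒫-spec ν)
          -- `h` sends `s` to the code under `g` of its image under `f`.
          h , _ , h-spec = relation
            (∃′ (maps′ i7 i0 i2 ∧′ ∀′ (i0 ∈′ i1 ⇔′ ∃′ (i0 ∈′ i3 ∧′ maps′ i8 i0 i1))))
            (f ∷ g ∷ []) (𝒫 x) θ
            (λ s ζ → ∃[ t ] Maps g t ζ × (∀ ξ → ξ ∈ t ⇔ (∃[ a ] a ∈ s × Maps f a ξ)))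
            (λ _ _ _ → refl)
          total : ∀ s → s ∈ 𝒫 x → ∃[ ζ ] ζ ∈ θ × Maps h s ζ
          total = λ s s∈𝒫x →
            let t , t-spec = separation (∃′ (i0 ∈′ i2 ∧′ maps′ i3 i0 i1)) (s ∷ f ∷ []) ν
                t∈𝒫ν = from (𝒫-spec ν t) λ ξ ξ∈t → proj₁ (to (t-spec ξ) ξ∈t)
                ζ , gtζ , _ = g-total t t∈𝒫ν
                ζ∈θ = proj₂ (function-∈ g-fun gtζ)
            in ζ , ζ∈θ , from (h-spec s ζ) (s∈𝒫x , ζ∈θ , t , gtζ , λ ξ →
                 mk⇔ (λ ξ∈t → proj₂ (to (t-spec ξ) ξ∈t))
                     (λ (a , a∈s , faξ) →
                       from (t-spec ξ) (proj₂ (function-∈ f-fun faξ) , a , a∈s , faξ)))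
          half : ∀ s s′ ζ → Maps h s ζ → Maps h s′ ζ → s ⊆ s′
          half = λ s s′ ζ hsζ hs′ζ a a∈s →
            let s∈𝒫x , _ , t , gtζ , t-spec = to (h-spec s ζ) hsζ
                _ , _ , t′ , gt′ζ , t′-spec = to (h-spec s′ ζ) hs′ζ
                ξ , faξ , _ = f-total a (to (𝒫-spec x s) s∈𝒫x a a∈s)
                a′ , a′∈s′ , fa′ξ = to (t′-spec ξ)
                  (subst (ξ ∈_) (g-inj t t′ ζ gtζ gt′ζ) (from (t-spec ξ) (a , a∈s , faξ)))
            in subst (_∈ s′) (f-inj a′ a ξ fa′ξ faξ) a′∈s′
      in θ , θ∈κ , h , total ,
         λ s s′ ζ hsζ hs′ζ → ⊆-antisym (half s s′ ζ hsζ hs′ζ) (half s′ s ζ hs′ζ hsζ)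

    small-∈ : ∀ {κ γ} → γ ∈ κ → Small κ γ
    small-∈ {γ = γ} γ∈κ =
      let h , _ , h-spec = relation (i0 ≐ i1) [] γ γ _≡_ (λ _ _ _ → refl)
          h-≡ : ∀ {a b} → Maps h a b → a ≡ b
          h-≡ = λ hab → proj₂ (proj₂ (to (h-spec _ _) hab))
      in γ , γ∈κ , h , (λ a a∈γ → a , a∈γ , from (h-spec a a) (a∈γ , a∈γ , refl)) ,
         λ a a′ b hab ha′b → trans (h-≡ hab) (sym (h-≡ ha′b))

    small⇒∩-bounded : ∀ {κ x} → Regular κ → Small κ x → ∃[ δ ] δ ∈ κ × (∀ ζ → ζ ∈ κ → ζ ∈ x → ζ ∈ δ)
    small⇒∩-bounded {κ} κ-reg x-small =
      let h , _ , h-spec = relation (i0 ≐ i1) [] κ κ _≡_ (λ _ _ _ → refl)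
          h-≡ : ∀ {a b} → Maps h a b → a ≡ b
          h-≡ = λ hab → proj₂ (proj₂ (to (h-spec _ _) hab))
          δ , δ∈κ , below = small⇒bounded κ-reg h (λ a b c hab hac → trans (sym (h-≡ hab)) (h-≡ hac)) x-small
      in δ , δ∈κ , λ ζ ζ∈κ ζ∈x → below ζ ζ∈x ζ ζ∈κ (from (h-spec ζ ζ) (ζ∈κ , ζ∈κ , refl))

    -- Zermelo's tower, the least family closed under unions and an inflationary operator G.
    -- It replaces transfinite recursion; G(D) is the set of elements to which g relates D.
    module Tower (g : V) (inflationary : ∀ {D η} → D ⊆ Ω → η ∈ D → Maps g D η) where

      G : V → V
      G D = proj₁ (separation (maps′ i1 i2 i0) (g ∷ D ∷ []) Ω)

      G-spec : ∀ D η → η ∈ G D ⇔ (η ∈ Ω × Maps g D η)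
      G-spec D = proj₂ (separation (maps′ i1 i2 i0) (g ∷ D ∷ []) Ω)

      ⊆G : ∀ {D} → D ⊆ Ω → D ⊆ G D
      ⊆G D⊆Ω η η∈D = from (G-spec _ η) (D⊆Ω η η∈D , inflationary D⊆Ω η∈D)

      -- `G D` and `⋃ D` enter through their defining conditions, since formulas have no function
      -- symbols. The empty family provides the bottom of the tower.
      Closed : V → Set ℓ
      Closed F =
        (∀ D → D ∈ F → ∀ E → (∀ η → η ∈ E ⇔ (η ∈ Ω × Maps g D η)) → E ∈ F) ×
        (∀ D → D ⊆ F → ∀ E → (∀ z → z ∈ E ⇔ (∃[ y ] y ∈ D × z ∈ y)) → E ∈ F)

      private
        tower = separation
          (∀′ ((∀′ (i0 ∈′ i1 ⇒′ ∀′ (∀′ (i0 ∈′ i1 ⇔′ i0 ∈′ i6 ∧′ maps′ i5 i2 i0) ⇒′ i0 ∈′ i2)) ∧′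
                ∀′ (i0 ⊆′ i1 ⇒′
                  ∀′ (∀′ (i0 ∈′ i1 ⇔′ ∃′ (i0 ∈′ i3 ∧′ i1 ∈′ i0)) ⇒′ i0 ∈′ i2))) ⇒′ i1 ∈′ i0))
          (g ∷ Ω ∷ []) (𝒫 Ω)

      𝒞 : V
      𝒞 = proj₁ tower

      𝒞-spec : ∀ u → u ∈ 𝒞 ⇔ (u ∈ 𝒫 Ω × (∀ F → Closed F → u ∈ F))
      𝒞-spec = proj₂ tower

      𝒞⇒⊆ : ∀ {u} → u ∈ 𝒞 → u ⊆ Ω
      𝒞⇒⊆ u∈𝒞 = to (𝒫-spec Ω _) (proj₁ (to (𝒞-spec _) u∈𝒞))

      G-∈𝒞 : ∀ {u} → u ∈ 𝒞 → G u ∈ 𝒞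
      G-∈𝒞 {u} u∈𝒞 = from (𝒞-spec (G u))
        (from (𝒫-spec Ω (G u)) (λ η η∈G → proj₁ (to (G-spec u η) η∈G)) ,
         λ F F-closed → proj₁ F-closed u (proj₂ (to (𝒞-spec u) u∈𝒞) F F-closed) (G u) (G-spec u))

      ⋃-∈𝒞 : ∀ {D} → D ⊆ 𝒞 → ⋃ D ∈ 𝒞
      ⋃-∈𝒞 {D} D⊆𝒞 = from (𝒞-spec (⋃ D))
        (from (𝒫-spec Ω (⋃ D)) (λ η η∈ →
           let u , u∈D , η∈u = to (⋃-spec D η) η∈ in 𝒞⇒⊆ (D⊆𝒞 u u∈D) η η∈u) ,
         λ F F-closed → proj₂ F-closed D
           (λ u u∈D → proj₂ (to (𝒞-spec u) (D⊆𝒞 u u∈D)) F F-closed) (⋃ D) (⋃-spec D))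

      𝒞-induction : ∀ {n} (φ : Formula (suc n)) (ρ : Vec V n) (P : V → Set ℓ) →
        (∀ u → Sat φ (u ∷ ρ) ≡ P u) →
        (∀ u → u ∈ 𝒞 → P u → P (G u)) →
        (∀ D → D ⊆ 𝒞 → (∀ u → u ∈ D → P u) → P (⋃ D)) →
        ∀ u → u ∈ 𝒞 → P u
      𝒞-induction φ ρ P φ≡P G-step ⋃-step u u∈𝒞 =
        proj₂ (to (F-spec u) (proj₂ (to (𝒞-spec u) u∈𝒞) F (G-closed , ⋃-closed)))
        where
        F = proj₁ (separation φ ρ 𝒞)

        F-spec : ∀ u → u ∈ F ⇔ (u ∈ 𝒞 × P u)
        F-spec u = subst (λ Q → u ∈ F ⇔ (u ∈ 𝒞 × Q)) (φ≡P u) (proj₂ (separation φ ρ 𝒞) u)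

        G-closed : ∀ D → D ∈ F → ∀ E → (∀ η → η ∈ E ⇔ (η ∈ Ω × Maps g D η)) → E ∈ F
        G-closed D D∈F E E-spec = subst (_∈ F) GD≡E
          (let D∈𝒞 , PD = to (F-spec D) D∈F in
           from (F-spec (G D)) (G-∈𝒞 D∈𝒞 , G-step D D∈𝒞 PD))
          where
          GD≡E : G D ≡ E
          GD≡E = extensionality _ _ λ η →
            mk⇔ (from (E-spec η) ∘ to (G-spec D η)) (from (G-spec D η) ∘ to (E-spec η))

        ⋃-closed : ∀ D → D ⊆ F → ∀ E → (∀ z → z ∈ E ⇔ (∃[ y ] y ∈ D × z ∈ y)) → E ∈ F
        ⋃-closed D D⊆F E E-spec = subst (_∈ F) ⋃D≡E (from (F-spec (⋃ D))
          (⋃-∈𝒞 (λ u u∈D → proj₁ (to (F-spec u) (D⊆F u u∈D))) ,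
           ⋃-step D (λ u u∈D → proj₁ (to (F-spec u) (D⊆F u u∈D)))
                    (λ u u∈D → proj₂ (to (F-spec u) (D⊆F u u∈D)))))
          where
          ⋃D≡E : ⋃ D ≡ E
          ⋃D≡E = extensionality _ _ λ z →
            mk⇔ (from (E-spec z) ∘ to (⋃-spec D z)) (from (⋃-spec D z) ∘ to (E-spec z))

      private
        -- These are the extreme points in the proof of the Bourbaki-Witt theorem: each is
        -- comparable with the whole tower, and a second induction shows that every member is one.
        Good : V → Set ℓ
        Good u = ∀ v → v ∈ 𝒞 → v ⊆ u → v ≢ u → G v ⊆ u

        good⇒comparable : ∀ {u} → u ∈ 𝒞 → Good u → ∀ v → v ∈ 𝒞 → v ⊆ u ⊎ G u ⊆ v
        good⇒comparable {u} u∈𝒞 u-good =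
          𝒞-induction (i0 ⊆′ i1 ∨′ i2 ⊆′ i0) (u ∷ G u ∷ []) (λ v → v ⊆ u ⊎ G u ⊆ v)
            (λ _ → refl) G-step ⋃-step
          where
          G-step : ∀ v → v ∈ 𝒞 → v ⊆ u ⊎ G u ⊆ v → G v ⊆ u ⊎ G u ⊆ G v
          G-step v v∈𝒞 (inj₂ Gu⊆v) = inj₂ λ η η∈ → ⊆G (𝒞⇒⊆ v∈𝒞) η (Gu⊆v η η∈)
          G-step v v∈𝒞 (inj₁ v⊆u) with em {v ≡ u}
          ... | yes refl = inj₂ λ _ → id
          ... | no v≢u = inj₁ (u-good v v∈𝒞 v⊆u v≢u)

          ⋃-step : ∀ D → D ⊆ 𝒞 → (∀ v → v ∈ D → v ⊆ u ⊎ G u ⊆ v) → ⋃ D ⊆ u ⊎ G u ⊆ ⋃ D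
          ⋃-step D D⊆𝒞 IH with em {∃[ v ] v ∈ D × G u ⊆ v}
          ... | yes (v , v∈D , Gu⊆v) = inj₂ λ η η∈ → ∈⋃ v∈D (Gu⊆v η η∈)
          ... | no none = inj₁ λ η η∈ →
            let v , v∈D , η∈v = to (⋃-spec D η) η∈ in
            [ (λ v⊆u → v⊆u η η∈v) , (λ Gu⊆v → ⊥-elim (none (v , v∈D , Gu⊆v))) ]′ (IH v v∈D)

        all-good : ∀ u → u ∈ 𝒞 → Good u
        all-good u u∈𝒞 v v∈𝒞 v⊆u v≢u η η∈ =
          let η∈Ω , gvη = to (G-spec v η) η∈ in unfolded u u∈𝒞 v v∈𝒞 v⊆u v≢u η η∈Ω gvη
          where
          -- `Good` with membership in `G v` unfolded, so that it is the meaning of a formula and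
          -- admits `𝒞-induction`.
          Good′ : V → Set ℓ
          Good′ u = ∀ v → v ∈ 𝒞 → v ⊆ u → v ≢ u → ∀ η → η ∈ Ω → Maps g v η → η ∈ u

          good : ∀ {u} → Good′ u → Good u
          good u-good v v∈𝒞 v⊆u v≢u η η∈ =
            let η∈Ω , gvη = to (G-spec v η) η∈ in u-good v v∈𝒞 v⊆u v≢u η η∈Ω gvη

          G-step : ∀ u → u ∈ 𝒞 → Good′ u → Good′ (G u)
          G-step u u∈𝒞 u-good v v∈𝒞 v⊆Gu v≢Gu η η∈Ω gvη
            with good⇒comparable u∈𝒞 (good u-good) v v∈𝒞
          ... | inj₂ Gu⊆v = ⊥-elim (v≢Gu (⊆-antisym v⊆Gu Gu⊆v))
          ... | inj₁ v⊆u with em {v ≡ u}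
          ...   | yes refl = from (G-spec u η) (η∈Ω , gvη)
          ...   | no v≢u = ⊆G (𝒞⇒⊆ u∈𝒞) η (u-good v v∈𝒞 v⊆u v≢u η η∈Ω gvη)

          ⋃-step : ∀ D → D ⊆ 𝒞 → (∀ u → u ∈ D → Good′ u) → Good′ (⋃ D)
          ⋃-step D D⊆𝒞 IH v v∈𝒞 v⊆⋃D v≢⋃D η η∈Ω gvη
            with ¬⊆⇒∃ (λ ⋃D⊆v → v≢⋃D (⊆-antisym v⊆⋃D ⋃D⊆v))
          ... | z , z∈⋃D , z∉v with to (⋃-spec D z) z∈⋃D
          ... | u , u∈D , z∈u with good⇒comparable (D⊆𝒞 u u∈D) (good (IH u u∈D)) v v∈𝒞
          ... | inj₂ Gu⊆v = ⊥-elim (z∉v (Gu⊆v z (⊆G (𝒞⇒⊆ (D⊆𝒞 u u∈D)) z z∈u)))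
          ... | inj₁ v⊆u =
            ∈⋃ u∈D (IH u u∈D v v∈𝒞 v⊆u (λ { refl → z∉v z∈u }) η η∈Ω gvη)

          unfolded : ∀ u → u ∈ 𝒞 → Good′ u
          unfolded = 𝒞-induction
            (∀′ (i0 ∈′ i2 ⇒′ i0 ⊆′ i1 ⇒′ ¬′ i0 ≐ i1 ⇒′
              ∀′ (i0 ∈′ i4 ⇒′ maps′ i5 i1 i0 ⇒′ i0 ∈′ i2)))
            (𝒞 ∷ Ω ∷ g ∷ []) Good′ (λ _ → refl) G-step ⋃-step

      comparable : ∀ {u v} → u ∈ 𝒞 → v ∈ 𝒞 → v ⊆ u ⊎ G u ⊆ v
      comparable {u} {v} u∈𝒞 v∈𝒞 = good⇒comparable u∈𝒞 (all-good u u∈𝒞) v v∈𝒞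

      -- The largest member of the tower that omits `δ`. It names a stage of the chain without an
      -- ordinal index: for `δ ∈ κ` its successor under `G` is the least member containing `δ`.
      avoiding : V → V
      avoiding δ = ⋃ (proj₁ (separation (¬′ i1 ∈′ i0) (δ ∷ []) 𝒞))

      avoiding-spec : ∀ δ ξ → ξ ∈ avoiding δ ⇔ (∃[ u ] u ∈ 𝒞 × ¬ (δ ∈ u) × ξ ∈ u)
      avoiding-spec δ ξ =
        let D , D-spec = separation (¬′ i1 ∈′ i0) (δ ∷ []) 𝒞 in
        mk⇔ (λ ξ∈ → let u , u∈D , ξ∈u = to (⋃-spec D ξ) ξ∈
                        u∈𝒞 , δ∉u = to (D-spec u) u∈D
                    in u , u∈𝒞 , δ∉u , ξ∈u)
            (λ (u , u∈𝒞 , δ∉u , ξ∈u) → ∈⋃ (from (D-spec u) (u∈𝒞 , δ∉u)) ξ∈u)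

      avoiding-∈𝒞 : ∀ δ → avoiding δ ∈ 𝒞
      avoiding-∈𝒞 δ =
        let D , D-spec = separation (¬′ i1 ∈′ i0) (δ ∷ []) 𝒞 in
        ⋃-∈𝒞 λ u u∈D → proj₁ (to (D-spec u) u∈D)

      ∉avoiding : ∀ δ → ¬ (δ ∈ avoiding δ)
      ∉avoiding δ δ∈ = let _ , _ , δ∉u , δ∈u = to (avoiding-spec δ δ) δ∈ in δ∉u δ∈u

      G-avoiding-⊆ : ∀ {δ v} → v ∈ 𝒞 → δ ∈ v → G (avoiding δ) ⊆ v
      G-avoiding-⊆ {δ} v∈𝒞 δ∈v =
        [ (λ v⊆ → ⊥-elim (∉avoiding δ (v⊆ δ δ∈v))) , id ]′ (comparable (avoiding-∈𝒞 δ) v∈𝒞)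

    -- A small set closed under an operator `e`, at an inaccessible point of a club

    module Closure {κ : V} (κ-reg : Regular κ) (κ-strong : StrongLimit κ) (κ⊆Ω : κ ⊆ Ω)
      {v₀ : V} (v₀⊆Ω : v₀ ⊆ Ω) (v₀-small : Small κ v₀)
      (e : V) (e⊆Ω : ∀ {w η} → Maps e w η → η ∈ Ω)
      (e-small : ∀ w → w ⊆ Ω → Small κ w → ∃[ y ] Small κ y × (∀ η → Maps e w η → η ∈ y))
      where

      private
        κ-ord : Ordinal κ
        κ-ord = proj₁ (proj₁ κ-reg)

        -- Values of `e` at all subsets of `D` are adjoined, whatever their size; the strong limit
        -- property keeps this step small.
        H : V → V → Set ℓ
        H D δ = δ ∈ D ⊎ δ ∈ v₀ ⊎ (∃[ w ] w ⊆ D × Maps e w δ)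

        h-relation = relation (i1 ∈′ i0 ∨′ i1 ∈′ i5 ∨′ ∃′ (i0 ⊆′ i1 ∧′ maps′ i7 i0 i2))
          (v₀ ∷ e ∷ []) (𝒫 Ω) Ω H (λ _ _ _ → refl)

        h : V
        h = proj₁ h-relation

        h-spec : ∀ D δ → Maps h D δ ⇔ (D ∈ 𝒫 Ω × δ ∈ Ω × H D δ)
        h-spec = proj₂ (proj₂ h-relation)

        -- The second disjunct adds to G(D) the ordinal sup {δ + 1 : δ ∈ H(D) ∩ κ} and its
        -- elements, so that G(D) ∩ κ is a successor ordinal.
        g-relation = relation
          (maps′ i6 i0 i1 ∨′
           (i1 ∈′ i5 ∧′ ∀′ (i0 ∈′ i2 ⇒′ ∃′ (i0 ∈′ i7 ∧′ maps′ i8 i2 i0 ∧′ (i1 ∈′ i0 ∨′ i1 ≐ i0)))))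
          (κ ∷ h ∷ []) (𝒫 Ω) Ω
          (λ D η → Maps h D η ⊎
                   (η ∈ κ × (∀ γ → γ ∈ η → ∃[ δ ] δ ∈ κ × Maps h D δ × γ ≤ₒ δ)))
          (λ _ _ _ → refl)

        g : V
        g = proj₁ g-relation

        g-spec : ∀ D η → Maps g D η ⇔ (D ∈ 𝒫 Ω × η ∈ Ω × (Maps h D η ⊎
          (η ∈ κ × (∀ γ → γ ∈ η → ∃[ δ ] δ ∈ κ × Maps h D δ × γ ≤ₒ δ))))
        g-spec = proj₂ (proj₂ g-relation)

        ∈-h : ∀ {D η} → D ⊆ Ω → η ∈ D → Maps h D η
        ∈-h {D} {η} D⊆Ω η∈D = from (h-spec D η) (from (𝒫-spec Ω D) D⊆Ω , D⊆Ω η η∈D , inj₁ η∈D)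

        h⇒g : ∀ {D η} → Maps h D η → Maps g D η
        h⇒g {D} {η} hDη = let D∈𝒫Ω , η∈Ω , _ = to (h-spec D η) hDη in
          from (g-spec D η) (D∈𝒫Ω , η∈Ω , inj₁ hDη)

      open Tower g (λ D⊆Ω η∈D → h⇒g (∈-h D⊆Ω η∈D))

      private
        h⊆G : ∀ {D η} → D ⊆ Ω → η ∈ Ω → H D η → η ∈ G D
        h⊆G {D} {η} D⊆Ω η∈Ω hDη = from (G-spec D η)
          (η∈Ω , h⇒g (from (h-spec D η) (from (𝒫-spec Ω D) D⊆Ω , η∈Ω , hDη)))

        ordinal-∈G : ∀ {D α} → D ⊆ Ω → α ∈ κ →
          (∀ γ → γ ∈ α → ∃[ δ ] δ ∈ κ × Maps h D δ × γ ≤ₒ δ) → α ∈ G D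
        ordinal-∈G {D} {α} D⊆Ω α∈κ below = from (G-spec D α)
          (κ⊆Ω α α∈κ , from (g-spec D α) (from (𝒫-spec Ω D) D⊆Ω , κ⊆Ω α α∈κ , inj₂ (α∈κ , below)))

        -- The least ordinal missing from `D` qualifies, as all its elements are in `D`. So the
        -- tower grows until it exhausts `κ`.
        G-adds : ∀ {D δ} → D ⊆ Ω → δ ∈ κ → ¬ (δ ∈ D) → ∃[ β ] β ∈ κ × ¬ (β ∈ D) × β ∈ G D
        G-adds {D} D⊆Ω δ∈κ δ∉D =
          let β , β∈κ , β∉D , minimal =
                least (¬′ (i0 ∈′ i1)) (D ∷ []) (λ β → ¬ (β ∈ D)) (λ _ → refl) δ∈κ δ∉D
          in β , β∈κ , β∉D , ordinal-∈G D⊆Ω β∈κ λ γ γ∈β →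
            let γ∈κ = transitive κ-ord β∈κ γ∈β
                γ∈D = byContradiction (minimal γ γ∈β γ∈κ)
            in γ , γ∈κ , ∈-h D⊆Ω γ∈D , inj₂ refl

        small-G : ∀ {D} → D ⊆ Ω → Small κ D → Small κ (G D)
        small-G {D} D⊆Ω D-small =
          let E , E-spec = separation (∃′ (i0 ⊆′ i2 ∧′ maps′ i3 i0 i1)) (D ∷ e ∷ []) Ω
              E⊆Ω = λ η η∈E → proj₁ (to (E-spec η) η∈E)
              E-small = small-⋃ κ-reg e (small-𝒫 κ-reg κ-strong D⊆Ω D-small)
                (λ w w∈𝒫D → let w⊆D = to (𝒫-spec D w) w∈𝒫D in
                  e-small w (λ z z∈w → D⊆Ω z (w⊆D z z∈w)) (small-⊆ w⊆D D-small))
                E⊆Ω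
                (λ η η∈E → let _ , w , w⊆D , ewη = to (E-spec η) η∈E in
                  w , from (𝒫-spec D w) w⊆D , ewη)
              v₀∪E-small = small-⊎ κ-reg
                (λ η η∈ → [ v₀⊆Ω η , E⊆Ω η ]′ (∪-elim η∈)) (λ _ → ∪-elim) v₀-small E-small
              hD , hD-spec = separation (maps′ i1 i2 i0) (h ∷ D ∷ []) Ω
              hD-small = small-⊎ κ-reg (λ η η∈ → proj₁ (to (hD-spec η) η∈))
                (λ η η∈ → let η∈Ω , hDη = to (hD-spec η) η∈
                              _ , _ , cases = to (h-spec D η) hDη
                          in map₂ [ ∪ˡ η , (λ (w , w⊆D , ewη) →
                               ∪ʳ η (from (E-spec η) (η∈Ω , w , w⊆D , ewη))) ]′ cases)
                D-small v₀∪E-small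
              -- The ordinals contributed by the second disjunct of `g` are at most `δ`: one above
              -- `δ` would require an element of `hD` in `κ` that is not below `δ`. Hence they all
              -- lie in `γ`.
              δ , δ∈κ , hD-below = small⇒∩-bounded κ-reg hD-small
              γ , γ∈κ , δ∈γ = upperBound κ-reg δ∈κ
              G-cases : ∀ η → η ∈ G D → η ∈ hD ⊎ η ∈ γ
              G-cases = λ η η∈G →
                let η∈Ω , gDη = to (G-spec D η) η∈G
                    _ , _ , cases = to (g-spec D η) gDη
                in [ (λ hDη → inj₁ (from (hD-spec η) (η∈Ω , hDη)))
                   , (λ (η∈κ , below) →
                       let η≤δ = ∌⇒≤ₒ κ-ord η∈κ δ∈κ λ δ∈η →
                             let ε , ε∈κ , hDε , δ≤ε = below δ δ∈η in
                             ≤ₒ⇒∌ δ≤ε (hD-below ε ε∈κ (from (hD-spec ε) (κ⊆Ω ε ε∈κ , hDε)))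
                       in inj₂ (≤ₒ-∈-trans κ-ord γ∈κ η≤δ δ∈γ)) ]′ cases
          in small-⊎ κ-reg (λ η η∈G → proj₁ (to (G-spec D η) η∈G)) G-cases
               hD-small (small-∈ γ∈κ)

        -- If `α` were this trace, each `γ ∈ α` would lie below some ordinal related to `D` by `h`,
        -- so `α` itself would be added. Successor stages thus never have limit height.
        G-not-limit : ∀ {D α} → D ⊆ Ω → α ∈ κ → LimitOrdinal α →
          ¬ (∀ ζ → ζ ∈ κ → ζ ∈ G D ⇔ ζ ∈ α)
        G-not-limit {D} {α} D⊆Ω α∈κ (_ , _ , limit) G∩κ≡α =
          ∈-irrefl (to (G∩κ≡α α α∈κ) (ordinal-∈G D⊆Ω α∈κ λ γ γ∈α →
            let γ′ , γ′∈α , γ∈γ′ = limit γ γ∈α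
                γ′∈κ = transitive κ-ord α∈κ γ′∈α
                _ , gDγ′ = to (G-spec D γ′) (from (G∩κ≡α γ′ γ′∈κ) γ′∈α)
                _ , _ , cases = to (g-spec D γ′) gDγ′
            in [ (λ hDγ′ → γ′ , γ′∈κ , hDγ′ , inj₁ γ∈γ′)
               , (λ (_ , below) → below γ γ∈γ′) ]′ cases))

        downward : ∀ u → u ∈ 𝒞 → ∀ η → η ∈ κ → η ∈ u → ∀ ζ → ζ ∈ η → ζ ∈ u
        downward = 𝒞-induction (∀′ (i0 ∈′ i2 ⇒′ i0 ∈′ i1 ⇒′ ∀′ (i0 ∈′ i1 ⇒′ i0 ∈′ i2))) (κ ∷ [])
          (λ u → ∀ η → η ∈ κ → η ∈ u → ∀ ζ → ζ ∈ η → ζ ∈ u) (λ _ → refl)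
          (λ u u∈𝒞 _ η η∈κ η∈G ζ ζ∈η →
            let _ , guη = to (G-spec u η) η∈G
                _ , _ , cases = to (g-spec u η) guη
                ζ∈κ = transitive κ-ord η∈κ ζ∈η
            in ordinal-∈G (𝒞⇒⊆ u∈𝒞) ζ∈κ λ γ γ∈ζ →
              let γ∈η = ∈-trans κ-ord η∈κ γ∈ζ ζ∈η in
              [ (λ huη → η , η∈κ , huη , inj₁ γ∈η) , (λ (_ , below) → below γ γ∈η) ]′ cases)
          (λ D D⊆𝒞 IH η η∈κ η∈⋃D ζ ζ∈η →
            let u , u∈D , η∈u = to (⋃-spec D η) η∈⋃D in
            ∈⋃ u∈D (IH u u∈D η η∈κ η∈u ζ ζ∈η))

        below-missing : ∀ {u δ ζ} → u ∈ 𝒞 → δ ∈ κ → ¬ (δ ∈ u) → ζ ∈ κ → ζ ∈ u → ζ ∈ δ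
        below-missing {u} {δ} {ζ} u∈𝒞 δ∈κ δ∉u ζ∈κ ζ∈u with trichotomy κ-ord ζ∈κ δ∈κ
        ... | inj₁ ζ∈δ = ζ∈δ
        ... | inj₂ (inj₁ refl) = ⊥-elim (δ∉u ζ∈u)
        ... | inj₂ (inj₂ δ∈ζ) = ⊥-elim (δ∉u (downward u u∈𝒞 ζ ζ∈κ ζ∈u δ δ∈ζ))

        -- Distinct members of the tower have distinct least missing ordinals, so only few
        -- members of the tower omit a given δ ∈ κ.
        few-avoid : ∀ {D δ} → D ⊆ 𝒞 → δ ∈ κ → (∀ u → u ∈ D → ¬ (δ ∈ u)) → Small κ D
        few-avoid {D} {δ} D⊆𝒞 δ∈κ δ∉ =
          let γ , γ∈κ , δ∈γ = upperBound κ-reg δ∈κ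
              f , _ , f-spec = relation (¬′ (i1 ∈′ i0) ∧′ ∀′ (i0 ∈′ i2 ⇒′ i0 ∈′ i1)) [] D γ
                (λ u β → ¬ (β ∈ u) × (∀ ζ → ζ ∈ β → ζ ∈ u)) (λ _ _ _ → refl)
              total : ∀ u → u ∈ D → ∃[ β ] β ∈ γ × Maps f u β
              total = λ u u∈D →
                let β , β∈κ , β∉u , minimal =
                      least (¬′ (i0 ∈′ i1)) (u ∷ []) (λ β → ¬ (β ∈ u)) (λ _ → refl) δ∈κ (δ∉ u u∈D)
                    β⊆u = λ ζ ζ∈β → byContradiction (minimal ζ ζ∈β (transitive κ-ord β∈κ ζ∈β))
                    β∈γ = ≤ₒ-∈-trans κ-ord γ∈κ
                      (∌⇒≤ₒ κ-ord β∈κ δ∈κ λ δ∈β → δ∉ u u∈D (β⊆u δ δ∈β)) δ∈γ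
                in β , β∈γ , from (f-spec u β) (u∈D , β∈γ , β∉u , β⊆u)
              half : ∀ u u′ β → Maps f u β → Maps f u′ β → u ⊆ u′
              half = λ u u′ β fuβ fu′β →
                let u∈D , β∈γ , β∉u , _ = to (f-spec u β) fuβ
                    u′∈D , _ , β∉u′ , β⊆u′ = to (f-spec u′ β) fu′β
                    u′⊆Ω = 𝒞⇒⊆ (D⊆𝒞 u′ u′∈D)
                    β∈κ = transitive κ-ord γ∈κ β∈γ
                    β∈Gu′ = ordinal-∈G u′⊆Ω β∈κ λ ζ ζ∈β →
                      ζ , transitive κ-ord β∈κ ζ∈β , ∈-h u′⊆Ω (β⊆u′ ζ ζ∈β) , inj₂ refl
                in [ id , (λ Gu′⊆u → ⊥-elim (β∉u (Gu′⊆u β β∈Gu′))) ]′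
                     (comparable (D⊆𝒞 u′ u′∈D) (D⊆𝒞 u u∈D))
          in γ , γ∈κ , f , total ,
             λ u u′ β fuβ fu′β → ⊆-antisym (half u u′ β fuβ fu′β) (half u′ u β fu′β fuβ)

        -- At a union, every member of the family omits `δ` too. By `few-avoid` the family is then
        -- small, and regularity applies.
        missing⇒small : ∀ u → u ∈ 𝒞 → ∀ δ → δ ∈ κ → ¬ (δ ∈ u) → Small κ u
        missing⇒small = 𝒞-induction (∀′ (i0 ∈′ i2 ⇒′ ¬′ (i0 ∈′ i1) ⇒′ small′ i2 i1)) (κ ∷ [])
          (λ u → ∀ δ → δ ∈ κ → ¬ (δ ∈ u) → Small κ u) (λ _ → refl)
          (λ u u∈𝒞 IH δ δ∈κ δ∉G →
            small-G (𝒞⇒⊆ u∈𝒞) (IH δ δ∈κ λ δ∈u → δ∉G (⊆G (𝒞⇒⊆ u∈𝒞) δ δ∈u)))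
          λ D D⊆𝒞 IH δ δ∈κ δ∉⋃ →
            let δ∉ = λ u u∈D δ∈u → δ∉⋃ (∈⋃ u∈D δ∈u)
                q , _ , q-spec = relation (i1 ∈′ i0) [] D Ω (λ u η → η ∈ u) (λ _ _ _ → refl)
            in small-⋃ κ-reg q (few-avoid D⊆𝒞 δ∈κ δ∉)
                 (λ u u∈D → u , IH u u∈D δ δ∈κ (δ∉ u u∈D) ,
                   λ η quη → proj₂ (proj₂ (to (q-spec u η) quη)))
                 (𝒞⇒⊆ (⋃-∈𝒞 D⊆𝒞))
                 (λ η η∈⋃ → let u , u∈D , η∈u = to (⋃-spec D η) η∈⋃ in
                   u , u∈D , from (q-spec u η) (u∈D , 𝒞⇒⊆ (D⊆𝒞 u u∈D) η η∈u , η∈u))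

        -- By maximality: otherwise `G (avoiding δ)` would omit `δ`, hence lie inside `avoiding δ`,
        -- although `G` adds a new ordinal.
        ∈G-avoiding : ∀ {δ} → δ ∈ κ → δ ∈ G (avoiding δ)
        ∈G-avoiding {δ} δ∈κ = byContradiction λ δ∉G →
          let u∈𝒞 = avoiding-∈𝒞 δ
              β , _ , β∉ , β∈G = G-adds (𝒞⇒⊆ u∈𝒞) δ∈κ (∉avoiding δ)
          in β∉ (from (avoiding-spec δ β) (G (avoiding δ) , G-∈𝒞 u∈𝒞 , δ∉G , β∈G))

      infix 4 _∩κ≐_

      _∩κ≐_ : V → V → Set ℓ
      v ∩κ≐ α = ∀ ζ → ζ ∈ κ → ζ ∈ v ⇔ ζ ∈ α

      heights : ∃[ c ] ∀ α → α ∈ c ⇔ (α ∈ κ × (∃[ v ] v ∈ 𝒞 × v ∩κ≐ α))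
      heights = separation (∃′ (i0 ∈′ i2 ∧′ ∀′ (i0 ∈′ i4 ⇒′ (i0 ∈′ i1 ⇔′ i0 ∈′ i2)))) (𝒞 ∷ κ ∷ []) κ

      -- The height of `G (avoiding β)` contains `β`, and it is a proper initial segment of `κ`
      -- because that set is small. A limit `α` of heights is the height of `avoiding α`, since
      -- members of height below `α` omit `α`.
      heights-club : IsClub (proj₁ heights) κ
      heights-club = (λ α α∈c → proj₁ (to (c-spec α) α∈c)) , unbounded , closed
        where
        c = proj₁ heights
        c-spec = proj₂ heights

        unbounded : ∀ β → β ∈ κ → ∃[ γ ] γ ∈ c × β ∈ γ
        unbounded β β∈κ =
          let u∈𝒞 = avoiding-∈𝒞 β
              v = G (avoiding β)
              v∈𝒞 = G-∈𝒞 u∈𝒞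
              v-small = small-G (𝒞⇒⊆ u∈𝒞) (missing⇒small _ u∈𝒞 β β∈κ (∉avoiding β))
              δ , δ∈κ , below = small⇒∩-bounded κ-reg v-small
              v∩κ-spec = ∩-spec v κ
              v∩κ∈κ : (v ∩ κ) ∈ κ
              v∩κ∈κ = [ (λ v∩κ≡κ → ⊥-elim (∈-irrefl (below δ δ∈κ
                          (proj₁ (to (v∩κ-spec δ) (subst (δ ∈_) (sym v∩κ≡κ) δ∈κ)))))) , id ]′
                (initialSegment κ-ord (λ ζ ζ∈ → proj₂ (to (v∩κ-spec ζ) ζ∈))
                  λ {α} {ζ} α∈ ζ∈α →
                    let α∈v , α∈κ = to (v∩κ-spec α) α∈ in
                    from (v∩κ-spec ζ) (downward v v∈𝒞 α α∈κ α∈v ζ ζ∈α , transitive κ-ord α∈κ ζ∈α))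
          in v ∩ κ ,
             from (c-spec (v ∩ κ)) (v∩κ∈κ , v , v∈𝒞 , λ ζ ζ∈κ →
               mk⇔ (λ ζ∈v → from (v∩κ-spec ζ) (ζ∈v , ζ∈κ)) (λ ζ∈ → proj₁ (to (v∩κ-spec ζ) ζ∈))) ,
             from (v∩κ-spec β) (∈G-avoiding β∈κ , β∈κ)

        closed : ∀ α → α ∈ κ → LimitOrdinal α →
          (∀ β → β ∈ α → ∃[ γ ] γ ∈ c × γ ∈ α × β ∈ γ) → α ∈ c
        closed α α∈κ _ cofinal = from (c-spec α)
          (α∈κ , avoiding α , avoiding-∈𝒞 α , λ ζ ζ∈κ →
            mk⇔ (below-missing (avoiding-∈𝒞 α) α∈κ (∉avoiding α) ζ∈κ)
                (λ ζ∈α →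
                  let γ , γ∈c , γ∈α , ζ∈γ = cofinal ζ ζ∈α
                      _ , v , v∈𝒞 , v∩κ≐γ = to (c-spec γ) γ∈c
                  in from (avoiding-spec α ζ) (v , v∈𝒞 ,
                       (λ α∈v → ∈-asym γ∈α (to (v∩κ≐γ α α∈κ) α∈v)) ,
                       from (v∩κ≐γ ζ ζ∈κ) ζ∈γ)))

      module _ {v α : V} (v∈𝒞 : v ∈ 𝒞) (α∈κ : α ∈ κ) (v∩κ≐α : v ∩κ≐ α) (α-reg : Regular α) where

        private
          ∈κ : ∀ {ζ} → ζ ∈ α → ζ ∈ κ
          ∈κ = transitive κ-ord α∈κ

          ∈v : ∀ {ζ} → ζ ∈ α → ζ ∈ v
          ∈v ζ∈α = from (v∩κ≐α _ (∈κ ζ∈α)) ζ∈α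

          -- `v` is a limit stage. Otherwise let `v′ = ⋃ D` be the union of the members omitting
          -- some element of `α`. Comparability gives `G v′ ⊆ v`, but `v′` already contains `α`, so
          -- the new ordinal added by `G` has no place in `v ∩ κ = α`.
          covered : ∀ {ξ} → ξ ∈ v → ∃[ δ ] δ ∈ α × ξ ∈ avoiding δ
          covered {ξ} ξ∈v = byContradiction λ none →
            let D , D-spec = separation (∃′ (i0 ∈′ i2 ∧′ ¬′ (i0 ∈′ i1))) (α ∷ []) 𝒞
                v′∈𝒞 = ⋃-∈𝒞 {D} λ u u∈D → proj₁ (to (D-spec u) u∈D)
                ξ∉v′ : ¬ (ξ ∈ ⋃ D)
                ξ∉v′ = λ ξ∈v′ →
                  let u , u∈D , ξ∈u = to (⋃-spec D ξ) ξ∈v′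
                      u∈𝒞 , δ , δ∈α , δ∉u = to (D-spec u) u∈D
                  in none (δ , δ∈α , from (avoiding-spec δ ξ) (u , u∈𝒞 , δ∉u , ξ∈u))
                Gv′⊆v : G (⋃ D) ⊆ v
                Gv′⊆v = [ (λ v⊆v′ → ⊥-elim (ξ∉v′ (v⊆v′ ξ ξ∈v))) , id ]′ (comparable v′∈𝒞 v∈𝒞)
                -- `G (avoiding δ)` contains `δ` and belongs to `D`: as a successor stage it cannot
                -- have the limit height `α`, so it omits some `δ′ ∈ α`.
                α⊆v′ : α ⊆ ⋃ D
                α⊆v′ = λ δ δ∈α →
                  let u∈𝒞 = avoiding-∈𝒞 δ
                      Gu⊆v = G-avoiding-⊆ v∈𝒞 (∈v δ∈α)
                      δ′ , δ′∈α , δ′∉Gu = ¬⊆⇒∃ {α} {G (avoiding δ)} λ α⊆Gu →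
                        G-not-limit (𝒞⇒⊆ u∈𝒞) α∈κ (proj₁ (proj₂ α-reg)) λ ζ ζ∈κ →
                          mk⇔ (λ ζ∈Gu → to (v∩κ≐α ζ ζ∈κ) (Gu⊆v ζ ζ∈Gu)) (α⊆Gu ζ)
                  in ∈⋃ (from (D-spec _) (G-∈𝒞 u∈𝒞 , δ′ , δ′∈α , δ′∉Gu)) (∈G-avoiding (∈κ δ∈α))
                α∉v′ : ¬ (α ∈ ⋃ D)
                α∉v′ = λ α∈v′ →
                  let u , u∈D , α∈u = to (⋃-spec D α) α∈v′
                      u∈𝒞 , δ , δ∈α , δ∉u = to (D-spec u) u∈D
                  in δ∉u (downward u u∈𝒞 α α∈κ α∈u δ δ∈α)
                β , β∈κ , β∉v′ , β∈Gv′ = G-adds (𝒞⇒⊆ v′∈𝒞) α∈κ α∉v′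
            in β∉v′ (α⊆v′ β (to (v∩κ≐α β β∈κ) (Gv′⊆v β β∈Gv′)))

        -- Regularity of `α` puts the elements of `w` into a single stage `avoiding δ` with `δ ∈ α`.
        -- The values of `e` at `w` appear one step later, still inside `v`.
        closed-under-e : ∀ w → w ⊆ v → ∀ ν → ν ∈ α → w ≼ ν → ∀ η → Maps e w η → η ∈ v
        closed-under-e w w⊆v ν ν∈α w≼ν η ewη =
          -- `r` relates `ξ` to the ordinals below `α` lying in every member that contains `ξ`: a
          -- substitute for the stage at which `ξ` appears.
          let r , _ , r-spec = relation (∀′ (i0 ∈′ i6 ⇒′ i1 ∈′ i0 ⇒′ i2 ∈′ i0)) (𝒞 ∷ []) w α
                (λ ξ ζ → ∀ u → u ∈ 𝒞 → ξ ∈ u → ζ ∈ u) (λ _ _ _ → refl)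
              δ , δ∈α , r-below = small⇒boundedRange α-reg r (ν , ν∈α , w≼ν) λ ξ ξ∈w →
                let δ , δ∈α , ξ∈ = covered (w⊆v ξ ξ∈w)
                    u , u∈𝒞 , δ∉u , ξ∈u = to (avoiding-spec δ ξ) ξ∈
                in δ , δ∈α , λ ζ ζ∈α rξζ →
                  let _ , _ , every = to (r-spec ξ ζ) rξζ in
                  below-missing u∈𝒞 (∈κ δ∈α) δ∉u (∈κ ζ∈α) (every u u∈𝒞 ξ∈u)
              w⊆avoiding : w ⊆ avoiding δ
              w⊆avoiding = λ ξ ξ∈w → byContradiction λ ξ∉ →
                ∈-irrefl (r-below ξ ξ∈w δ δ∈α (from (r-spec ξ δ) (ξ∈w , δ∈α , λ u u∈𝒞 ξ∈u →
                  byContradiction λ δ∉u → ξ∉ (from (avoiding-spec δ ξ) (u , u∈𝒞 , δ∉u , ξ∈u)))))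
          in G-avoiding-⊆ v∈𝒞 (∈v δ∈α) η
               (h⊆G (𝒞⇒⊆ (avoiding-∈𝒞 δ)) (e⊆Ω ewη) (inj₂ (inj₂ (w , w⊆avoiding , ewη))))

        v₀⊆v : v₀ ⊆ v
        v₀⊆v η η∈v₀ =
          let _ , (_ , (δ , δ∈α) , _) , _ = α-reg in
          G-avoiding-⊆ v∈𝒞 (∈v δ∈α) η
            (h⊆G (𝒞⇒⊆ (avoiding-∈𝒞 δ)) (v₀⊆Ω η η∈v₀) (inj₂ (inj₁ η∈v₀)))

      -- `α ∉ v` makes `v` small, and `v ∩ κ = α` turns a size bound `ν ∈ v` into one below `α`.
      small-closure : Mahlo κ → ∃[ y ] y ⊆ Ω × Small κ y × v₀ ⊆ y ×
        (∀ w → w ⊆ y → ∀ ν → ν ∈ κ → ν ∈ y → w ≼ ν → ∀ η → Maps e w η → η ∈ y)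
      small-closure (_ , _ , inaccessible-spec , _ , stationary) =
        let α , α∈c , α∈e = stationary _ heights-club
            α∈κ , _ , α-reg , _ = to (inaccessible-spec α) α∈e
            _ , v , v∈𝒞 , v∩κ≐α = to (proj₂ heights α) α∈c
            α∉v = λ α∈v → ∈-irrefl (to (v∩κ≐α α α∈κ) α∈v)
        in v , 𝒞⇒⊆ v∈𝒞 , missing⇒small v v∈𝒞 α α∈κ α∉v , v₀⊆v v∈𝒞 α∈κ v∩κ≐α α-reg ,
           λ w w⊆v ν ν∈κ ν∈v →
             closed-under-e v∈𝒞 α∈κ v∩κ≐α α-reg w w⊆v ν (to (v∩κ≐α ν ν∈κ) ν∈v)

    -- Traces, lifts, and projection of reflection

    trace-exists : ∀ {μ x} → Regular μ → x ⊆ Ω → ∀ T → ∃[ R ] IsTrace R T μ x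
    trace-exists {μ} {x} μ-reg x⊆Ω T =
      let R , R-spec = separation (i0 ⊆′ i1 ∧′ small′ i2 i0) (x ∷ μ ∷ []) T in
      R , λ z → mk⇔
        (λ z∈R → let z∈T , z⊆x , z-small = to (R-spec z) z∈R in
          z∈T , z⊆x , small⇒size μ-reg (λ ζ ζ∈z → x⊆Ω ζ (z⊆x ζ ζ∈z)) z-small)
        (λ (z∈T , z⊆x , z-size) → from (R-spec z) (z∈T , z⊆x , size⇒small z-size))

    lift-exists : ∀ {κ A B} → Regular κ → B ⊆ Ω → ∀ T → ∃[ T′ ] IsLift T′ T κ A B
    lift-exists {κ} {A} {B} κ-reg B⊆Ω T =
      let T′ , T′-spec = separation
            (small′ i1 i0 ∧′ ∃′ (∀′ (i0 ∈′ i1 ⇔′ i0 ∈′ i2 ∧′ i0 ∈′ i4) ∧′ i0 ∈′ i4))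
            (κ ∷ A ∷ T ∷ []) (𝒫 B)
      in T′ , λ y → mk⇔
        (λ y∈T′ →
          let y∈𝒫B , y-small , z = to (T′-spec y) y∈T′
              y⊆B = to (𝒫-spec B y) y∈𝒫B
          in (y⊆B , small⇒size κ-reg (λ ζ ζ∈y → B⊆Ω ζ (y⊆B ζ ζ∈y)) y-small) , z)
        (λ ((y⊆B , y-size) , z) →
          from (T′-spec y) (from (𝒫-spec B y) y⊆B , size⇒small y-size , z))

    lift-unbounded : ∀ {κ A B T T′} → Regular κ → A ⊆ B → B ⊆ Ω → T ⊆𝒫[ κ ] A →
      Unbounded κ A T → IsLift T′ T κ A B → Unbounded κ B T′
    lift-unbounded {κ} {A} {B} κ-reg A⊆B B⊆Ω T⊆𝒫 T-unbounded T′-lift z (z⊆B , z-size) =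
      let z∩A-spec = ∩-spec z A
          z∩A⊆z = λ ζ ζ∈ → proj₁ (to (z∩A-spec ζ) ζ∈)
          t , t∈T , z∩A⊆t = T-unbounded (z ∩ A)
            ((λ ζ ζ∈ → proj₂ (to (z∩A-spec ζ) ζ∈)) ,
             small⇒size κ-reg (λ ζ ζ∈ → B⊆Ω ζ (z⊆B ζ (z∩A⊆z ζ ζ∈)))
               (small-⊆ z∩A⊆z (size⇒small z-size)))
          t⊆A , t-size = T⊆𝒫 t t∈T
          w⊆B : (t ∪ z) ⊆ B
          w⊆B = λ ζ ζ∈ → [ (λ ζ∈t → A⊆B ζ (t⊆A ζ ζ∈t)) , z⊆B ζ ]′ (∪-elim ζ∈)
          w⊆Ω = λ ζ ζ∈ → B⊆Ω ζ (w⊆B ζ ζ∈)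
      -- Since `z ∩ A ⊆ t ⊆ A`, intersecting `t ∪ z` with `A` gives back `t`.
      in t ∪ z ,
         from (T′-lift (t ∪ z))
           ((w⊆B , small⇒size κ-reg w⊆Ω
              (small-⊎ κ-reg w⊆Ω (λ _ → ∪-elim) (size⇒small t-size) (size⇒small z-size))) ,
            t , (λ ζ → mk⇔ (λ ζ∈t → ∪ˡ ζ ζ∈t , t⊆A ζ ζ∈t)
                   (λ (ζ∈w , ζ∈A) →
                     [ id , (λ ζ∈z → z∩A⊆t ζ (from (z∩A-spec ζ) (ζ∈z , ζ∈A))) ]′ (∪-elim ζ∈w))) ,
            t∈T) ,
         ∪ʳ

    intersection-project : ∀ {κ A x y μ} → κ ⊆ A →
      IsIntersection x y A → IsIntersection μ y κ → IsIntersection μ x κ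
    intersection-project κ⊆A x-spec μ-spec ζ = mk⇔
      (λ ζ∈μ → let ζ∈y , ζ∈κ = to (μ-spec ζ) ζ∈μ in from (x-spec ζ) (ζ∈y , κ⊆A ζ ζ∈κ) , ζ∈κ)
      (λ (ζ∈x , ζ∈κ) → from (μ-spec ζ) (proj₁ (to (x-spec ζ) ζ∈x) , ζ∈κ))

    -- Traces commute with lifts because `w ∩ A = w ∩ x` for `w ⊆ y`. This presents the trace at `y`
    -- as a lift, to which projection can be applied.
    lift-trace : ∀ {κ A B x y μ T T′ R R′} → Regular κ → y ⊆ Ω → y ⊆ B → Small κ y →
      IsIntersection x y A → Regular μ →
      IsLift T′ T κ A B → IsTrace R′ T′ μ y → IsTrace R T μ x → IsLift R′ R μ x y
    lift-trace κ-reg y⊆Ω y⊆B y-small x-spec μ-reg T′-lift R′-trace R-trace w = mk⇔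
      (λ w∈R′ →
        let w∈T′ , w⊆y , w-size = to (R′-trace w) w∈R′
            _ , t , t-spec , t∈T = to (T′-lift w) w∈T′
            t⊆w = λ ζ ζ∈t → proj₁ (to (t-spec ζ) ζ∈t)
            t⊆x = λ ζ ζ∈t → from (x-spec ζ) (w⊆y ζ (t⊆w ζ ζ∈t) , proj₂ (to (t-spec ζ) ζ∈t))
        in (w⊆y , w-size) , t ,
           (λ ζ → mk⇔ (λ ζ∈t → t⊆w ζ ζ∈t , t⊆x ζ ζ∈t)
                      (λ (ζ∈w , ζ∈x) → from (t-spec ζ) (ζ∈w , proj₂ (to (x-spec ζ) ζ∈x)))) ,
           from (R-trace t) (t∈T , t⊆x ,
             small⇒size μ-reg (λ ζ ζ∈t → y⊆Ω ζ (w⊆y ζ (t⊆w ζ ζ∈t)))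
               (small-⊆ t⊆w (size⇒small w-size))))
      (λ ((w⊆y , w-size) , t , t-spec , t∈R) →
        let t∈T , _ = to (R-trace t) t∈R
        in from (R′-trace w)
          (from (T′-lift w)
            (((λ ζ ζ∈w → y⊆B ζ (w⊆y ζ ζ∈w)) ,
              small⇒size κ-reg (λ ζ ζ∈w → y⊆Ω ζ (w⊆y ζ ζ∈w)) (small-⊆ w⊆y y-small)) ,
             t , (λ ζ → mk⇔
                   (λ ζ∈t → let ζ∈w , ζ∈x = to (t-spec ζ) ζ∈t in ζ∈w , proj₂ (to (x-spec ζ) ζ∈x))
                   (λ (ζ∈w , ζ∈A) → from (t-spec ζ) (ζ∈w , from (x-spec ζ) (w⊆y ζ ζ∈w , ζ∈A)))) ,
             t∈T) ,
           w⊆y , w-size))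

    -- The generality serves two uses: at `κ` for the given sets, and at `μ` for `x ⊆ y`, inside a
    -- reflecting point.
    project-reflects : ∀ {κ A B S S′} → Regular κ → κ ⊆ A → A ⊆ B → B ⊆ Ω →
      IsLift S′ S κ A B → Reflects Unbounded κ B S′ → Reflects Unbounded κ A S
    project-reflects κ-reg κ⊆A A⊆B B⊆Ω S′-lift reflects T T⊆𝒫 T-unbounded =
      let T′ , T′-lift = lift-exists κ-reg B⊆Ω T
          y , μ , R′ , y∈S′ , μ-spec , μ-inaccessible , R′-trace , R′-unbounded =
            reflects T′ (λ y y∈T′ → proj₁ (to (T′-lift y) y∈T′))
              (lift-unbounded κ-reg A⊆B B⊆Ω T⊆𝒫 T-unbounded T′-lift)
          (y⊆B , y-size) , x , x-spec , x∈S = to (S′-lift y) y∈S′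
          _ , μ-reg , _ = μ-inaccessible
          y⊆Ω = λ ζ ζ∈y → B⊆Ω ζ (y⊆B ζ ζ∈y)
          x⊆y = λ ζ ζ∈x → proj₁ (to (x-spec ζ) ζ∈x)
          R , R-trace = trace-exists μ-reg (λ ζ ζ∈x → y⊆Ω ζ (x⊆y ζ ζ∈x)) T
          R′-lift = lift-trace κ-reg y⊆Ω y⊆B (size⇒small y-size) x-spec μ-reg T′-lift R′-trace R-trace
      in x , μ , R , x∈S , intersection-project κ⊆A x-spec μ-spec , μ-inaccessible , R-trace ,
         λ w (w⊆x , w-size) →
           let w′ , w′∈R′ , w⊆w′ = R′-unbounded w ((λ ζ ζ∈w → x⊆y ζ (w⊆x ζ ζ∈w)) , w-size)
               _ , t , t-spec , t∈R = to (R′-lift w′) w′∈R′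
           in t , t∈R , λ ζ ζ∈w → from (t-spec ζ) (w⊆w′ ζ ζ∈w , w⊆x ζ ζ∈w)

    -- Reflection of unbounded sets by lifts, and the final assembly

    module _ {κ : V} (κ-mahlo : Mahlo κ) {A : V} (κ⊆A : κ ⊆ A) (A⊆Ω : A ⊆ Ω) where

      private
        κ-reg : Regular κ
        κ-reg = let (_ , reg , _) , _ = κ-mahlo in reg

        κ-strong : StrongLimit κ
        κ-strong = let (_ , _ , strong) , _ = κ-mahlo in strong

      -- Every x ∈ 𝒫_κ A has a hull N(x), the least y ⊇ x closed under e on subsets of size
      -- in x ∩ κ. The sets v containing N(z) ∩ A for all z ⊆ v are unbounded, so some x ∈ T
      -- reflects them, and then x′ is the union of the N(z) for z ∈ 𝒫_μ x.
      reflects-to-closed : ∀ {T} → T ⊆𝒫[ κ ] A → Reflects Unbounded κ A T →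
        (e : V) (e⊆Ω : ∀ {w η} → Maps e w η → η ∈ Ω)
        (e-small : ∀ w → w ⊆ Ω → Small κ w → ∃[ y ] Small κ y × (∀ η → Maps e w η → η ∈ y)) →
        ∃[ x ] ∃[ μ ] ∃[ x′ ] x ∈ T × IsIntersection μ x κ × WeaklyInaccessible μ ×
          x′ ⊆ Ω × Small κ x′ × IsIntersection x x′ A ×
          (∀ w → w ⊆ x′ → Small μ w → ∀ η → Maps e w η → η ∈ x′)
      reflects-to-closed {T} T⊆𝒫 reflects e e⊆Ω e-small =
        x , μ , x′ , x∈T , μ-spec , μ-inaccessible , x′⊆Ω , x′-small , x-spec , x′-closed
        where
        -- The size bounds `ν` are taken from the fixed `z`, so the hull is defined before `μ` is
        -- known. Once `z ⊆ x`, they all lie in `x ∩ κ = μ`.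
        HullClosed : V → V → Set ℓ
        HullClosed z y = ∀ w → w ⊆ y → ∀ ν → ν ∈ κ → ν ∈ z → w ≼ ν → ∀ ζ → Maps e w ζ → ζ ∈ y

        InHull : V → V → Set ℓ
        InHull z η = ∀ y → y ⊆ Ω → z ⊆ y → HullClosed z y → η ∈ y

        hull-relation = relation
          (∀′ (i0 ⊆′ i5 ⇒′ i1 ⊆′ i0 ⇒′
            ∀′ (i0 ⊆′ i1 ⇒′ ∀′ (i0 ∈′ i8 ⇒′ i0 ∈′ i3 ⇒′ i1 ≼′ i0 ⇒′
              ∀′ (maps′ (suc i9) i2 i0 ⇒′ i0 ∈′ i3))) ⇒′ i2 ∈′ i0))
          (κ ∷ e ∷ []) (𝒫 Ω) Ω InHull (λ _ _ _ → refl)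

        N : V
        N = proj₁ hull-relation

        N-spec : ∀ z η → Maps N z η ⇔ (z ∈ 𝒫 Ω × η ∈ Ω × InHull z η)
        N-spec = proj₂ (proj₂ hull-relation)

        small-closure : ∀ {v} → v ⊆ Ω → Small κ v → ∃[ y ] y ⊆ Ω × Small κ y × v ⊆ y ×
          (∀ w → w ⊆ y → ∀ ν → ν ∈ κ → ν ∈ y → w ≼ ν → ∀ η → Maps e w η → η ∈ y)
        small-closure v⊆Ω v-small =
          Closure.small-closure κ-reg κ-strong (λ ζ ζ∈κ → A⊆Ω ζ (κ⊆A ζ ζ∈κ)) v⊆Ω v-small
            e e⊆Ω e-small κ-mahlo

        W-separation = separation
          (small′ i1 i0 ∧′
           ∀′ (i0 ⊆′ i1 ⇒′ ∀′ (i0 ∈′ i4 ⇒′ maps′ i5 i1 i0 ⇒′ i0 ∈′ i2)))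
          (κ ∷ A ∷ N ∷ []) (𝒫 A)

        W : V
        W = proj₁ W-separation

        W-spec : ∀ v → v ∈ W ⇔
          (v ∈ 𝒫 A × Small κ v × (∀ z → z ⊆ v → ∀ η → η ∈ A → Maps N z η → η ∈ v))
        W-spec = proj₂ W-separation

        W⊆𝒫 : W ⊆𝒫[ κ ] A
        W⊆𝒫 v v∈W =
          let v∈𝒫A , v-small , _ = to (W-spec v) v∈W
              v⊆A = to (𝒫-spec A v) v∈𝒫A
          in v⊆A , small⇒size κ-reg (λ ζ ζ∈v → A⊆Ω ζ (v⊆A ζ ζ∈v)) v-small

        -- If `y` is closed for all sizes in `y ∩ κ`, it contains the hull of every `z ⊆ y`, so
        -- `y ∩ A` belongs to `W`.
        W-unbounded : Unbounded κ A W
        W-unbounded v (v⊆A , v-size) =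
          let y , y⊆Ω , y-small , v⊆y , y-closed =
                small-closure (λ ζ ζ∈v → A⊆Ω ζ (v⊆A ζ ζ∈v)) (size⇒small v-size)
              y∩A-spec = ∩-spec y A
              y∩A⊆y = λ ζ ζ∈ → proj₁ (to (y∩A-spec ζ) ζ∈)
          in y ∩ A ,
             from (W-spec (y ∩ A))
               (from (𝒫-spec A (y ∩ A)) (λ ζ ζ∈ → proj₂ (to (y∩A-spec ζ) ζ∈)) ,
                small-⊆ y∩A⊆y y-small ,
                λ z z⊆y∩A η η∈A Nzη →
                  let _ , _ , in-hull = to (N-spec z η) Nzη
                      z⊆y = λ ζ ζ∈z → y∩A⊆y ζ (z⊆y∩A ζ ζ∈z)
                  in from (y∩A-spec η)
                       (in-hull y y⊆Ω z⊆y (λ w w⊆y ν ν∈κ ν∈z → y-closed w w⊆y ν ν∈κ (z⊆y ν ν∈z)) ,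
                        η∈A)) ,
             λ ζ ζ∈v → from (y∩A-spec ζ) (v⊆y ζ ζ∈v , v⊆A ζ ζ∈v)

        reflection = reflects W W⊆𝒫 W-unbounded

        x μ R : V
        x = proj₁ reflection
        μ = proj₁ (proj₂ reflection)
        R = proj₁ (proj₂ (proj₂ reflection))

        x∈T : x ∈ T
        x∈T = let _ , _ , _ , x∈T , _ = reflection in x∈T

        μ-spec : IsIntersection μ x κ
        μ-spec = let _ , _ , _ , _ , μ-spec , _ = reflection in μ-spec

        μ-inaccessible : WeaklyInaccessible μ
        μ-inaccessible = let _ , _ , _ , _ , _ , inaccessible , _ = reflection in inaccessible

        μ-reg : Regular μ
        μ-reg = let _ , reg , _ = μ-inaccessible in reg

        R-trace : IsTrace R W μ x
        R-trace = let _ , _ , _ , _ , _ , _ , trace , _ = reflection in trace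

        R-unbounded : Unbounded μ x R
        R-unbounded = let _ , _ , _ , _ , _ , _ , _ , unb = reflection in unb

        x⊆A : x ⊆ A
        x⊆A = proj₁ (T⊆𝒫 x x∈T)

        x⊆Ω : x ⊆ Ω
        x⊆Ω ζ ζ∈x = A⊆Ω ζ (x⊆A ζ ζ∈x)

        -- Reflection is used here: some `v ∈ W` lies between `z` and `x`, and it absorbs the part
        -- of the hull inside `A`.
        hull∩A⊆x : ∀ {z η} → z ⊆ x → Small μ z → η ∈ A → Maps N z η → η ∈ x
        hull∩A⊆x {z} {η} z⊆x z-small η∈A Nzη =
          let v , v∈R , z⊆v = R-unbounded z
                (z⊆x , small⇒size μ-reg (λ ζ ζ∈z → x⊆Ω ζ (z⊆x ζ ζ∈z)) z-small)
              v∈W , v⊆x , _ = to (R-trace v) v∈R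
              _ , _ , v-closed = to (W-spec v) v∈W
          in v⊆x η (v-closed z z⊆v η η∈A Nzη)

        x′-separation = separation (∃′ (i0 ⊆′ i2 ∧′ small′ i3 i0 ∧′ maps′ i4 i0 i1))
          (x ∷ μ ∷ N ∷ []) Ω

        x′ : V
        x′ = proj₁ x′-separation

        x′-spec : ∀ η → η ∈ x′ ⇔ (η ∈ Ω × (∃[ z ] z ⊆ x × Small μ z × Maps N z η))
        x′-spec = proj₂ x′-separation

        x′⊆Ω : x′ ⊆ Ω
        x′⊆Ω η η∈x′ = proj₁ (to (x′-spec η) η∈x′)

        x⊆x′ : x ⊆ x′
        x⊆x′ η η∈x = from (x′-spec η)
          (x⊆Ω η η∈x , ⟅ η ⟆ , (λ ζ ζ∈ → subst (_∈ x) (sym (∈⟅x⟆ ζ∈)) η∈x) ,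
           small-⟅⟆ μ-reg (x⊆Ω η η∈x) ,
           from (N-spec ⟅ η ⟆ η)
             (from (𝒫-spec Ω ⟅ η ⟆) (λ ζ ζ∈ → subst (_∈ Ω) (sym (∈⟅x⟆ ζ∈)) (x⊆Ω η η∈x)) ,
              x⊆Ω η η∈x , λ y _ η⊆y _ → η⊆y η x∈⟅x⟆))

        x-spec : IsIntersection x x′ A
        x-spec η = mk⇔ (λ η∈x → x⊆x′ η η∈x , x⊆A η η∈x)
          (λ (η∈x′ , η∈A) → let _ , z , z⊆x , z-small , Nzη = to (x′-spec η) η∈x′ in
            hull∩A⊆x z⊆x z-small η∈A Nzη)

        -- One small closed set containing `x` contains the hulls of all subsets of `x`.
        x′-small : Small κ x′
        x′-small =
          let y , y⊆Ω , y-small , x⊆y , y-closed =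
                small-closure x⊆Ω (size⇒small (proj₂ (T⊆𝒫 x x∈T)))
          in small-⊆ (λ η η∈x′ →
               let _ , z , z⊆x , _ , Nzη = to (x′-spec η) η∈x′
                   _ , _ , in-hull = to (N-spec z η) Nzη
                   z⊆y = λ ζ ζ∈z → x⊆y ζ (z⊆x ζ ζ∈z)
               in in-hull y y⊆Ω z⊆y λ w w⊆y ν ν∈κ ν∈z → y-closed w w⊆y ν ν∈κ (z⊆y ν ν∈z)) y-small

        -- Each `ξ ∈ w` lies in the hull of some set in 𝒫_μ x. Fewer than `μ` of these sets are
        -- chosen, so their union is small and its hull contains `w`.
        x′-closed : ∀ w → w ⊆ x′ → Small μ w → ∀ η → Maps e w η → η ∈ x′
        x′-closed w w⊆x′ w-small@(ν , ν∈μ , w≼ν) η ewη =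
          let r , _ , r-spec = relation (small′ i5 i1 ∧′ maps′ i6 i1 i0) (μ ∷ N ∷ []) w (𝒫 x)
                (λ ξ z → Small μ z × Maps N z ξ) (λ _ _ _ → refl)
              f , f-total , f-functional , f⊆r = uniformize r w (𝒫 x) λ ξ ξ∈w →
                let _ , z , z⊆x , z-small , Nzξ = to (x′-spec ξ) (w⊆x′ ξ ξ∈w)
                    z∈𝒫x = from (𝒫-spec x z) z⊆x
                in z , z∈𝒫x , from (r-spec ξ z) (ξ∈w , z∈𝒫x , z-small , Nzξ)
              q , _ , q-spec = relation (∃′ (maps′ i6 i1 i0 ∧′ i2 ∈′ i0)) (f ∷ []) w Ω
                (λ ξ ζ → ∃[ z ] Maps f ξ z × ζ ∈ z) (λ _ _ _ → refl)
              z₀ , z₀-spec = separation (∃′ (i0 ∈′ i2 ∧′ maps′ i3 i0 i1)) (w ∷ q ∷ []) x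
              z₀⊆x = λ ζ ζ∈z₀ → proj₁ (to (z₀-spec ζ) ζ∈z₀)
              z₀-small = small-⋃ μ-reg q w-small
                (λ ξ ξ∈w →
                  let z , fξz = f-total ξ ξ∈w
                      _ , rξz = f⊆r ξ z fξz
                      _ , _ , z-small , _ = to (r-spec ξ z) rξz
                  in z , z-small , λ ζ qξζ →
                    let _ , _ , z′ , fξz′ , ζ∈z′ = to (q-spec ξ ζ) qξζ in
                    subst (ζ ∈_) (f-functional ξ z′ z fξz′ fξz) ζ∈z′)
                (λ ζ ζ∈z₀ → x⊆Ω ζ (z₀⊆x ζ ζ∈z₀))
                (λ ζ ζ∈z₀ → proj₂ (to (z₀-spec ζ) ζ∈z₀))
              ν∈x , ν∈κ = to (μ-spec ν) ν∈μ
              -- Adding `ν` makes the size of `w` one of those for which the hull of `z` is closed.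
              z = z₀ ∪ ⟅ ν ⟆
              z⊆x : z ⊆ x
              z⊆x = λ ζ ζ∈z →
                [ z₀⊆x ζ , (λ ζ∈ → subst (_∈ x) (sym (∈⟅x⟆ ζ∈)) ν∈x) ]′ (∪-elim ζ∈z)
              z⊆Ω : z ⊆ Ω
              z⊆Ω = λ ζ ζ∈z → x⊆Ω ζ (z⊆x ζ ζ∈z)
              z-small = small-⊎ μ-reg z⊆Ω (λ _ → ∪-elim) z₀-small (small-⟅⟆ μ-reg (x⊆Ω ν ν∈x))
              fibre⊆z : ∀ {ξ zξ} → ξ ∈ w → Maps f ξ zξ → zξ ⊆ z
              fibre⊆z = λ {ξ} {zξ} ξ∈w fξz ζ ζ∈zξ →
                let zξ∈𝒫x , _ = f⊆r ξ zξ fξz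
                    ζ∈x = to (𝒫-spec x zξ) zξ∈𝒫x ζ ζ∈zξ
                in ∪ˡ ζ (from (z₀-spec ζ)
                     (ζ∈x , ξ , ξ∈w , from (q-spec ξ ζ) (ξ∈w , x⊆Ω ζ ζ∈x , zξ , fξz , ζ∈zξ)))
              w⊆hull : ∀ y → y ⊆ Ω → z ⊆ y → HullClosed z y → w ⊆ y
              w⊆hull = λ y y⊆Ω z⊆y y-closed ξ ξ∈w →
                let zξ , fξz = f-total ξ ξ∈w
                    _ , rξz = f⊆r ξ zξ fξz
                    _ , _ , _ , Nzξ = to (r-spec ξ zξ) rξz
                    _ , _ , in-hull = to (N-spec zξ ξ) Nzξ
                    zξ⊆z = fibre⊆z ξ∈w fξz
                in in-hull y y⊆Ω (λ ζ ζ∈ → z⊆y ζ (zξ⊆z ζ ζ∈))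
                     λ w′ w′⊆y ν′ ν′∈κ ν′∈zξ → y-closed w′ w′⊆y ν′ ν′∈κ (zξ⊆z ν′ ν′∈zξ)
          in from (x′-spec η) (e⊆Ω ewη , z , z⊆x , z-small ,
               from (N-spec z η) (from (𝒫-spec Ω z) z⊆Ω , e⊆Ω ewη , λ y y⊆Ω z⊆y y-closed →
                 y-closed w (w⊆hull y y⊆Ω z⊆y y-closed) ν ν∈κ (∪ʳ ν x∈⟅x⟆) w≼ν η ewη))

      -- e(w) consists of the elements of some u ∈ U containing w, together with the size of u.
      cofinal-operator : ∀ {U} → U ⊆𝒫[ κ ] Ω → Unbounded κ Ω U →
        ∃[ e ] (∀ {w η} → Maps e w η → η ∈ Ω) ×
          (∀ w → w ⊆ Ω → Small κ w → ∃[ y ] Small κ y × (∀ η → Maps e w η → η ∈ y)) ×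
          (∀ w → w ⊆ Ω → Small κ w → ∃[ u ] ∃[ θ ] u ∈ U × w ⊆ u × θ ∈ κ × u ≼ θ ×
            (∀ η → η ∈ u → Maps e w η) × Maps e w θ)
      cofinal-operator {U} U⊆𝒫 U-unbounded =
        e , (λ ewη → proj₁ (proj₂ (to (e-spec _ _) ewη))) , e-small , e-cofinal
        where
        κ-ord : Ordinal κ
        κ-ord = proj₁ (proj₁ κ-reg)

        κ⊆Ω : κ ⊆ Ω
        κ⊆Ω ζ ζ∈κ = A⊆Ω ζ (κ⊆A ζ ζ∈κ)

        PΩ-separation = separation (small′ i1 i0) (κ ∷ []) (𝒫 Ω)

        PΩ : V
        PΩ = proj₁ PΩ-separation

        ∈PΩ : ∀ {w} → w ⊆ Ω → Small κ w → w ∈ PΩ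
        ∈PΩ {w} w⊆Ω w-small = from (proj₂ PΩ-separation w) (from (𝒫-spec Ω w) w⊆Ω , w-small)

        r-relation = relation (i0 ⊆′ i1) [] PΩ U _⊆_ (λ _ _ _ → refl)

        uniformization = uniformize (proj₁ r-relation) PΩ U λ w w∈PΩ →
          let w∈𝒫Ω , w-small = to (proj₂ PΩ-separation w) w∈PΩ
              w⊆Ω = to (𝒫-spec Ω w) w∈𝒫Ω
              u , u∈U , w⊆u = U-unbounded w (w⊆Ω , small⇒size κ-reg w⊆Ω w-small)
          in u , u∈U , from (proj₂ (proj₂ r-relation) w u) (w∈PΩ , u∈U , w⊆u)

        f : V
        f = proj₁ uniformization

        f-functional : Functional f
        f-functional = proj₁ (proj₂ (proj₂ uniformization))

        f-value : ∀ {w} → w ∈ PΩ → ∃[ u ] Maps f w u × u ∈ U × w ⊆ u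
        f-value {w} w∈PΩ =
          let _ , f-total , _ , f⊆r = uniformization
              u , fwu = f-total w w∈PΩ
              u∈U , rwu = f⊆r w u fwu
          in u , fwu , u∈U , proj₂ (proj₂ (to (proj₂ (proj₂ r-relation) w u) rwu))

        -- Leastness makes `θ` unique, so `e` adds a single element to `u` and its value stays
        -- small.
        IsSize : V → V → Set ℓ
        IsSize u θ = θ ∈ κ × u ≼ θ × (∀ α → α ∈ θ → ¬ (u ≼ α))

        size-exists : ∀ {u} → u ∈ U → ∃[ θ ] IsSize u θ
        size-exists {u} u∈U =
          let α , α∈κ , u≼α = size⇒small (proj₂ (U⊆𝒫 u u∈U))
              θ , θ∈κ , u≼θ , minimal = least (i1 ≼′ i0) (u ∷ []) (u ≼_) (λ _ → refl) α∈κ u≼α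
          in θ , θ∈κ , u≼θ , λ α α∈θ → minimal α α∈θ (transitive κ-ord θ∈κ α∈θ)

        size-unique : ∀ {u θ η} → IsSize u θ → IsSize u η → η ≡ θ
        size-unique {θ = θ} {η} (θ∈κ , u≼θ , θ-least) (η∈κ , u≼η , η-least)
          with trichotomy κ-ord η∈κ θ∈κ
        ... | inj₁ η∈θ = ⊥-elim (θ-least η η∈θ u≼η)
        ... | inj₂ (inj₁ η≡θ) = η≡θ
        ... | inj₂ (inj₂ θ∈η) = ⊥-elim (η-least θ θ∈η u≼θ)

        e-relation = relation
          (∃′ (maps′ i6 i1 i0 ∧′
            (i2 ∈′ i0 ∨′ i2 ∈′ i7 ∧′ i0 ≼′ i2 ∧′ ∀′ (i0 ∈′ i3 ⇒′ ¬′ (i1 ≼′ i0)))))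
          (f ∷ κ ∷ []) PΩ Ω
          (λ w η → ∃[ u ] Maps f w u × (η ∈ u ⊎ IsSize u η)) (λ _ _ _ → refl)

        e : V
        e = proj₁ e-relation

        e-spec : ∀ w η → Maps e w η ⇔
          (w ∈ PΩ × η ∈ Ω × (∃[ u ] Maps f w u × (η ∈ u ⊎ IsSize u η)))
        e-spec = proj₂ (proj₂ e-relation)

        e-value : ∀ {w η u θ} → Maps f w u → IsSize u θ → Maps e w η → η ∈ (u ∪ ⟅ θ ⟆)
        e-value {w} {η} {u} {θ} fwu θ-size ewη =
          let _ , _ , u′ , fwu′ , cases = to (e-spec w η) ewη in
          member (f-functional w u′ u fwu′ fwu) cases
          where
          member : ∀ {u′} → u′ ≡ u → η ∈ u′ ⊎ IsSize u′ η → η ∈ (u ∪ ⟅ θ ⟆)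
          member refl (inj₁ η∈u) = ∪ˡ η η∈u
          member refl (inj₂ η-size) =
            ∪ʳ η (subst (_∈ ⟅ θ ⟆) (sym (size-unique {u} {θ} {η} θ-size η-size)) x∈⟅x⟆)

        e-small : ∀ w → w ⊆ Ω → Small κ w → ∃[ y ] Small κ y × (∀ η → Maps e w η → η ∈ y)
        e-small w w⊆Ω w-small =
          let u , fwu , u∈U , _ = f-value (∈PΩ w⊆Ω w-small)
              θ , θ-size = size-exists u∈U
          in u ∪ ⟅ θ ⟆ ,
             small-⊎ κ-reg
               (λ η η∈ → [ proj₁ (U⊆𝒫 u u∈U) η
                         , (λ η∈ → subst (_∈ Ω) (sym (∈⟅x⟆ η∈)) (κ⊆Ω θ (proj₁ θ-size))) ]′
                         (∪-elim η∈))
               (λ _ → ∪-elim)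
               (size⇒small (proj₂ (U⊆𝒫 u u∈U))) (small-⟅⟆ κ-reg (κ⊆Ω θ (proj₁ θ-size))) ,
             λ η → e-value fwu θ-size

        e-cofinal : ∀ w → w ⊆ Ω → Small κ w → ∃[ u ] ∃[ θ ] u ∈ U × w ⊆ u × θ ∈ κ × u ≼ θ ×
          (∀ η → η ∈ u → Maps e w η) × Maps e w θ
        e-cofinal w w⊆Ω w-small =
          let w∈PΩ = ∈PΩ w⊆Ω w-small
              u , fwu , u∈U , w⊆u = f-value w∈PΩ
              θ , θ-size = size-exists u∈U
              θ∈κ , u≼θ , _ = θ-size
          in u , θ , u∈U , w⊆u , θ∈κ , u≼θ ,
             (λ η η∈u → from (e-spec w η)
               (w∈PΩ , proj₁ (U⊆𝒫 u u∈U) η η∈u , u , fwu , inj₁ η∈u)) ,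
             from (e-spec w θ) (w∈PΩ , κ⊆Ω θ θ∈κ , u , fwu , inj₂ θ-size)

      lift-reflects : ∀ {T T′} → T ⊆𝒫[ κ ] A → Reflects Unbounded κ A T → IsLift T′ T κ A Ω →
        Reflects Unbounded κ Ω T′
      lift-reflects {T} {T′} T⊆𝒫 T-reflects T′-lift U U⊆𝒫 U-unbounded =
        let e , e⊆Ω , e-small , e-cofinal = cofinal-operator U⊆𝒫 U-unbounded
            x , μ , x′ , x∈T , μ-spec , μ-inaccessible , x′⊆Ω , x′-small , x-spec , x′-closed =
              reflects-to-closed T⊆𝒫 T-reflects e e⊆Ω e-small
            _ , μ-reg , _ = μ-inaccessible
            R , R-trace = trace-exists μ-reg x′⊆Ω U
        in x′ , μ , R ,
           from (T′-lift x′) ((x′⊆Ω , small⇒size κ-reg x′⊆Ω x′-small) , x , x-spec , x∈T) ,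
           (λ ζ → mk⇔
             (λ ζ∈μ → let ζ∈x , ζ∈κ = to (μ-spec ζ) ζ∈μ in proj₁ (to (x-spec ζ) ζ∈x) , ζ∈κ)
             (λ (ζ∈x′ , ζ∈κ) →
               from (μ-spec ζ) (from (x-spec ζ) (ζ∈x′ , κ⊆A ζ ζ∈κ) , ζ∈κ))) ,
           μ-inaccessible , R-trace ,
           λ w (w⊆x′ , w-size) →
             let u , θ , u∈U , w⊆u , θ∈κ , u≼θ , u⊆e , θ∈e =
                   e-cofinal w (λ ζ ζ∈w → x′⊆Ω ζ (w⊆x′ ζ ζ∈w)) (small-⊆ w⊆x′ x′-small)
                 closed = x′-closed w w⊆x′ (size⇒small w-size)
                 u⊆x′ : u ⊆ x′
                 u⊆x′ = λ η η∈u → closed η (u⊆e η η∈u)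
                 -- Closure puts the size of `u` into `x′ ∩ κ = μ`, which is what places `u` in 𝒫_μ
                 -- x′.
                 θ∈μ = from (μ-spec θ) (from (x-spec θ) (closed θ θ∈e , κ⊆A θ θ∈κ) , θ∈κ)
             in u ,
                from (R-trace u)
                  (u∈U , u⊆x′ , small⇒size μ-reg (proj₁ (U⊆𝒫 u u∈U)) (θ , θ∈μ , u≼θ)) ,
                w⊆u

      -- The clause `m = 0` is a projection at `κ`. For `m = 1`, `S′` reflects the lift of `T` at
      -- some `y`; the trace there is the lift of `R` from `x` to `y`, so a second projection, at
      -- `μ`, gives the claim for `R`.
      lift-reflects-stationary : ∀ {S S′} → IsLift S′ S κ A Ω →
        Stationary 2 κ Ω S′ → Stationary 2 κ A S
      lift-reflects-stationary {S} S′-lift ((_ , reflects₀) , reflects₁) =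
        (tt , project-reflects κ-reg κ⊆A A⊆Ω (λ _ → id) S′-lift reflects₀) , λ T T⊆𝒫 (_ , T-reflects) →
          let T′ , T′-lift = lift-exists κ-reg (λ _ → id) T
              y , μ , R′ , y∈S′ , μ-spec , μ-inaccessible , R′-trace , _ , R′-reflects =
                reflects₁ T′ (λ y y∈T′ → proj₁ (to (T′-lift y) y∈T′))
                  (tt , lift-reflects T⊆𝒫 T-reflects T′-lift)
              (y⊆Ω , y-size) , x , x-spec , x∈S = to (S′-lift y) y∈S′
              _ , μ-reg , _ = μ-inaccessible
              x⊆y = λ ζ ζ∈x → proj₁ (to (x-spec ζ) ζ∈x)
              R , R-trace = trace-exists μ-reg (λ ζ ζ∈x → y⊆Ω ζ (x⊆y ζ ζ∈x)) T
              μ-spec-x = intersection-project κ⊆A x-spec μ-spec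
              R′-lift = lift-trace κ-reg y⊆Ω y⊆Ω (size⇒small y-size) x-spec μ-reg T′-lift R′-trace R-trace
          in x , μ , R , x∈S , μ-spec-x , μ-inaccessible , R-trace , tt ,
             project-reflects μ-reg (λ ζ ζ∈μ → proj₁ (to (μ-spec-x ζ) ζ∈μ)) x⊆y y⊆Ω R′-lift R′-reflects

proposition4p8 : {ℓ : Level} → ExcludedMiddle ℓ →
    (V : Set ℓ) (_∈_ : V → V → Set ℓ) → let open SetTheory V _∈_ in
    ZFC →
    (κ lam lam′ : V) → Mahlo κ → Cardinal lam → Cardinal lam′ →
    κ ≤ₒ lam → lam ∈ lam′ →
    (S S↑lam′ : V) → S ⊆𝒫[ κ ] lam → IsLift S↑lam′ S κ lam lam′ →
    Stationary 2 κ lam′ S↑lam′ → Stationary 2 κ lam S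
proposition4p8 em V _∈_ zfc κ lam lam′ κ-mahlo (lam-ord , _) (lam′-ord , _) κ≤lam lam∈lam′
  S S↑lam′ _ S↑-lift =
  lift-reflects-stationary κ-mahlo κ⊆lam (proj₁ lam′-ord lam lam∈lam′) S↑-lift
  where
  open SetTheory V _∈_
  open Theory em V _∈_ zfc
  open WithinOrdinal lam′ lam′-ord

  κ⊆lam : κ ⊆ lam
  κ⊆lam = [ proj₁ lam-ord κ , (λ { refl _ → id }) ]′ κ≤lam
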